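{- Let $P_1$ and $P_2$ be distinct places in a function field $F/K$ of genus $g$. For all integers $i,j\geq 0$, $$G_{i,j}=G_{i+j,0}+\mathbf{w}_j.$$ In particular, $$|G_0(P_1,P_2)|=\sum_{k=0}^{\lceil (2g-1)/\pi\rceil-1}(k+1)|G_{k,0}|.$$
   Context: $K$ is the algebraic closure of a finite field $\mathbb{F}_q$ and $F/K$ is a function field of one variable of genus $g$. $\mathbb{N}$ is the set of positive integers and $\mathbb{N}_0=\mathbb{N}\cup\{0\}$. $\ell(D)$ is the $K$-dimension of the Riemann-Roch space of a divisor $D$. A pair $(s_1,s_2)\in\mathbb{N}_0^2$ is a pure gap at $P_1,P_2$ if $\ell(s_1P_1+s_2P_2)=\ell(s_1P_1+s_2P_2-P_j)$ for all $j\in\{1,2\}$; $G_0(P_1,P_2)$ is the set of pure gaps at $P_1,P_2$. The period is $\pi=\min\{k\in\mathbb{N}:k(P_1-P_2)\text{ is a principal divisor}\}$. For $k_1,k_2\in\mathbb{N}_0$, $G_{k_1,k_2}=G_0(P_1,P_2)\cap\left((k_1\pi,(k_1+1)\pi]\times(k_2\pi,(k_2+1)\pi]\right)$. For $j\in\mathbb{N}_0$, $\mathbf{w}_j=(-j\pi,j\pi)\in\mathbb{Z}^2$, and for a set $S$, $S+\mathbf{w}_j$ denotes its translate. -}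

module Defs where

open import Level using (Level; Lift; _⊔_)
open import Algebra.Apartness.Bundles using (HeytingField)
open import Algebra.Bundles using (CommutativeRing)
open import Algebra.Morphism.Structures using (module RingMorphisms)
open import Axiom.ExcludedMiddle using (ExcludedMiddle)
open import Data.Bool.Base using (if_then_else_)
open import Data.Fin.Base using (Fin)
open import Data.Integer.Base as ℤ using (ℤ; +_; -[1+_])
open import Data.List.Base using (List; []; _∷_; foldr; length; map; upTo; sum)
open import Data.List.Membership.Propositional using () renaming (_∈_ to _∈ˡ_)
open import Data.List.Relation.Unary.All using (All)
open import Data.List.Relation.Unary.Any using (Any)
open import Data.List.Relation.Unary.Unique.Propositional using (Unique)
open import Data.Nat.Base as ℕ using (ℕ; suc; NonZero)
open import Data.Product.Base using (Σ; ∃; ∃-syntax; _×_; _,_)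
open import Function.Base using (id)
open import Function.Bundles using (Inverse; _⇔_)
open import Relation.Binary.Construct.Add.Supremum.NonStrict ℤ._≤_ using (_≤⁺_)
open import Relation.Binary.PropositionalEquality.Core using (_≡_)
open import Relation.Binary.PropositionalEquality.Properties using (setoid)
open import Relation.Nullary.Construct.Add.Supremum using (_⁺; ⊤⁺; [_])
open import Relation.Nullary.Decidable.Core using (does)
open import Relation.Nullary.Negation.Core using (¬_)
open import Relation.Unary using (Pred; _∈_)

-- Fields are the library's Heyting fields.  The theorem assumes excluded
-- middle, under which the apartness of such a field is just _≉_.

module Field {ℓ : Level} (K : HeytingField ℓ ℓ ℓ) where
  open HeytingField K public using (Carrier; _≈_; _+_; _*_; -_; _-_; 0#; 1#)

  commutativeRing : CommutativeRing ℓ ℓ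
  commutativeRing = record { isCommutativeRing = HeytingField.isCommutativeRing K }

  open CommutativeRing commutativeRing public using (rawRing) renaming (setoid to ≈-setoid)
  open import Algebra.Definitions.RawMonoid (CommutativeRing.+-rawMonoid commutativeRing) public
    using () renaming (sum to ∑)

  infix 4 _≉_
  _≉_ : Carrier → Carrier → Set ℓ
  x ≉ y = ¬ (x ≈ y)

IsFieldHom : ∀ {ℓ} (k L : HeytingField ℓ ℓ ℓ) → (Field.Carrier k → Field.Carrier L) → Set ℓ
IsFieldHom k L = RingMorphisms.IsRingHomomorphism (Field.rawRing k) (Field.rawRing L)

-- A polynomial is its list of coefficients, constant term first.
module Polynomial {ℓ} (k L : HeytingField ℓ ℓ ℓ) (φ : Field.Carrier k → Field.Carrier L) where
  private
    module k = Field k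
    module L = Field L

  eval : List k.Carrier → L.Carrier → L.Carrier
  eval p x = foldr (λ a r → φ a L.+ x L.* r) L.0# p

  Algebraic : L.Carrier → Set ℓ
  Algebraic x = ∃[ p ] Any (k._≉ k.0#) p × eval p x L.≈ L.0#

  Transcendental : L.Carrier → Set ℓ
  Transcendental x = ¬ Algebraic x

  -- membership in the subfield k(x) of L
  _∈k⟨_⟩ : L.Carrier → L.Carrier → Set ℓ
  z ∈k⟨ x ⟩ = ∃[ p ] ∃[ r ] eval r x L.≉ L.0# × z L.* eval r x L.≈ eval p x

  IsFunctionField : Set ℓ
  IsFunctionField = ∃[ x ] Transcendental x ×
    ∃[ n ] Σ (Fin n → L.Carrier) λ y → ∀ z →
      Σ (Fin n → L.Carrier) λ c → (∀ i → c i ∈k⟨ x ⟩) × z L.≈ L.∑ λ i → c i L.* y i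

IsAlgebraicallyClosed : ∀ {ℓ} → HeytingField ℓ ℓ ℓ → Set ℓ
IsAlgebraicallyClosed K = ∀ a as → Any (_≉ 0#) as → ∃[ x ] eval (a ∷ as) x ≈ 0#
  where
  open Field K
  open Polynomial K K id

HasOrder : ∀ {ℓ} → HeytingField ℓ ℓ ℓ → ℕ → Set ℓ
HasOrder k q = Inverse (Field.≈-setoid k) (setoid (Fin q))

record IsAlgebraicClosure {ℓ} (k K : HeytingField ℓ ℓ ℓ)
         (σ : Field.Carrier k → Field.Carrier K) : Set ℓ where
  field
    isFieldHom            : IsFieldHom k K σ
    algebraic             : ∀ x → Polynomial.Algebraic k K σ x
    isAlgebraicallyClosed : IsAlgebraicallyClosed K

ℤ∞ : Set
ℤ∞ = ℤ ⁺

_+∞_ : ℤ∞ → ℤ∞ → ℤ∞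
[ m ] +∞ [ n ] = [ m ℤ.+ n ]
[ m ] +∞ ⊤⁺    = ⊤⁺
⊤⁺    +∞ _     = ⊤⁺

_⊓∞_ : ℤ∞ → ℤ∞ → ℤ∞
[ m ] ⊓∞ [ n ] = [ m ℤ.⊓ n ]
[ m ] ⊓∞ ⊤⁺    = [ m ]
⊤⁺    ⊓∞ n     = n

HasCard : ∀ {a p} {A : Set a} → Pred A p → ℕ → Set (a ⊔ p)
HasCard S n = ∃[ xs ] Unique xs × (∀ x → x ∈ S ⇔ x ∈ˡ xs) × length xs ≡ n

-- The sum of f k over 0 ≤ k ≤ n, empty when n is negative.
∑₀ : ℤ → (ℕ → ℕ) → ℕ
∑₀ (+ n)    f = sum (map f (upTo (suc n)))
∑₀ -[1+ _ ] f = 0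

_⊕_ : ∀ {p} → Pred (ℤ × ℤ) p → ℤ × ℤ → Pred (ℤ × ℤ) p
(S ⊕ (w₁ , w₂)) t = ∃[ s₁ ] ∃[ s₂ ] (s₁ , s₂) ∈ S × t ≡ (s₁ ℤ.+ w₁ , s₂ ℤ.+ w₂)

-- Excluded middle enters the definitions only to compare places when
-- collecting the coefficients of a formal sum.
module FunctionField {ℓ} (em : ExcludedMiddle ℓ) (K F : HeytingField ℓ ℓ ℓ)
         (ι : Field.Carrier K → Field.Carrier F) where
  private
    module K = Field K
  open Field F

  -- A place is given by its normalised discrete valuation, trivial on K.
  record Place : Set ℓ where
    field
      v        : Carrier → ℤ∞
      v-cong   : ∀ {x y} → x ≈ y → v x ≡ v y
      v≡∞⇔x≈0  : ∀ x → v x ≡ ⊤⁺ ⇔ x ≈ 0#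
      v-*      : ∀ x y → v (x * y) ≡ v x +∞ v y
      v-+      : ∀ x y → (v x ⊓∞ v y) ≤⁺ v (x + y)
      v-const  : ∀ a → a K.≉ K.0# → v (ι a) ≡ [ ℤ.0ℤ ]
      v-onto-1 : ∃[ t ] v t ≡ [ ℤ.1ℤ ]
  open Place public using (v)

  infix 4 _≈ᵖ_
  _≈ᵖ_ : Place → Place → Set ℓ
  P ≈ᵖ Q = ∀ z → v P z ≡ v Q z

  -- dim_K U/W = n, for K-subspaces W ⊆ U of F
  HasDim : Pred Carrier ℓ → Pred Carrier ℓ → ℕ → Set ℓ
  HasDim U W n = Σ (Fin n → Carrier) λ b →
      (∀ i → b i ∈ U)
    × (∀ a → comb a b ∈ W → ∀ i → a i K.≈ K.0#)
    × (∀ z → z ∈ U → ∃[ a ] (z - comb a b) ∈ W)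
    where
    comb : (Fin n → K.Carrier) → (Fin n → Carrier) → Carrier
    comb a b = ∑ λ i → ι (a i) * b i

  -- [F_P : K] = d, where F_P is the residue field of P
  PlaceDegree : Place → ℕ → Set ℓ
  PlaceDegree P = HasDim (v≥ ℤ.0ℤ) (v≥ ℤ.1ℤ)
    where
    v≥ : ℤ → Pred Carrier ℓ
    v≥ n z = Lift ℓ ([ n ] ≤⁺ v P z)

  -- A divisor is a formal sum of places; a place may be listed repeatedly,
  -- so the divisor is determined by its coefficients.
  Divisor : Set ℓ
  Divisor = List (ℤ × Place)

  coeff : Divisor → Place → ℤ
  coeff D P = foldr (λ (n , Q) s → (if does (em {Q ≈ᵖ P}) then n else ℤ.0ℤ) ℤ.+ s) ℤ.0ℤ D

  infix 4 _HasDegree_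
  data _HasDegree_ : Divisor → ℤ → Set ℓ where
    []  : [] HasDegree ℤ.0ℤ
    _∷_ : ∀ {n P D d e} → PlaceDegree P d → D HasDegree e →
          ((n , P) ∷ D) HasDegree (n ℤ.* + d ℤ.+ e)

  IsPrincipal : Divisor → Set ℓ
  IsPrincipal D = ∃[ f ] f ≉ 0# × (∀ P → v P f ≡ [ coeff D P ])

  -- The Riemann–Roch space; it contains 0 because v P 0 = ∞.
  L : Divisor → Pred Carrier ℓ
  L D z = ∀ P → [ ℤ.- coeff D P ] ≤⁺ v P z

  -- ℓ(D) = n
  RRDim : Divisor → ℕ → Set ℓ
  RRDim D = HasDim (L D) (_≈ 0#)

  -- g = max { deg D − ℓ(D) + 1 | D a divisor }
  record IsGenus (g : ℕ) : Set ℓ where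
    field
      attained : ∃[ D ] ∃[ d ] ∃[ n ] D HasDegree d × RRDim D n × d ℤ.- + n ℤ.+ ℤ.1ℤ ≡ + g
      bound    : ∀ D d n → D HasDegree d → RRDim D n → d ℤ.- + n ℤ.+ ℤ.1ℤ ℤ.≤ + g

  module TwoPlaces (P₁ P₂ : Place) where

    record IsPeriod (π : ℕ) .{{_ : NonZero π}} : Set ℓ where
      field
        principal : IsPrincipal ((+ π , P₁) ∷ (ℤ.- + π , P₂) ∷ [])
        minimal   : ∀ k .{{_ : NonZero k}} →
                    IsPrincipal ((+ k , P₁) ∷ (ℤ.- + k , P₂) ∷ []) → π ℕ.≤ k

    _•_ : ℤ → ℤ → Divisor
    s₁ • s₂ = (s₁ , P₁) ∷ (s₂ , P₂) ∷ []

    -- Pure gaps are pairs of nonnegative integers, regarded inside ℤ × ℤ so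
    -- that they can be translated by vectors with negative entries.
    G₀ : Pred (ℤ × ℤ) ℓ
    G₀ (s₁ , s₂) = ℤ.0ℤ ℤ.≤ s₁ × ℤ.0ℤ ℤ.≤ s₂
      × (∃[ n ] RRDim (s₁ • s₂) n × RRDim ((ℤ.-1ℤ , P₁) ∷ s₁ • s₂) n)
      × (∃[ n ] RRDim (s₁ • s₂) n × RRDim ((ℤ.-1ℤ , P₂) ∷ s₁ • s₂) n)

    module Boxes (π : ℕ) where

      G : ℕ → ℕ → Pred (ℤ × ℤ) ℓ
      G k₁ k₂ (s₁ , s₂) = (s₁ , s₂) ∈ G₀
        × (+ (k₁ ℕ.* π) ℤ.< s₁ × s₁ ℤ.≤ + (suc k₁ ℕ.* π))
        × (+ (k₂ ℕ.* π) ℤ.< s₂ × s₂ ℤ.≤ + (suc k₂ ℕ.* π))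

      w : ℕ → ℤ × ℤ
      w j = ℤ.- + (j ℕ.* π) , + (j ℕ.* π)

{-# OPTIONS --safe #-}

-- Multiplication by a power of the function with divisor π (P₁ − P₂) gives
-- isomorphisms of Riemann–Roch spaces, hence the translation statement.  For
-- the count it remains to see that G_{k,0} is empty once k π ≥ 2g − 1.  No
-- Riemann–Roch theorem is needed: a pole order s₁ of functions regular outside
-- P₁ is never the first coordinate of a pure gap; since deg D − ℓ(D) + 1 ≤ g,
-- at most g natural numbers fail to be such a pole order; and as pole orders
-- form a semigroup, every s₁ ≥ 2g is one.
--
-- The dimension count requires residue fields equal to K, which follows by
-- reducing an algebraic equation over K(x) modulo the place, and L(−P) = 0,
-- which holds because the divisor attaining the genus forces some nonzero
-- L(D + P) to be finite dimensional.
module Submission where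

open import Defs
open import Algebra.Apartness.Bundles using (HeytingField)
open import Algebra.Bundles using (CommutativeRing)
open import Algebra.Morphism.Structures using (module RingMorphisms)
import Algebra.Properties.AbelianGroup
import Algebra.Properties.Ring
import Algebra.Properties.Semiring.Exp
import Algebra.Properties.Semiring.Mult
import Algebra.Properties.Semiring.Sum
import Algebra.Solver.Ring
open import Algebra.Solver.Ring.AlmostCommutativeRing using (fromCommutativeRing; _-Raw-AlmostCommutative⟶_)
open import Axiom.ExcludedMiddle using (ExcludedMiddle)
open import Data.Bool.Base using (if_then_else_)
open import Data.Fin.Base as Fin using (Fin; zero; suc; punchIn; toℕ)
import Data.Fin.Properties as Fin
open import Data.Integer.Base as ℤ using (ℤ; +_; -[1+_])
import Data.Integer.DivMod as ℤ
import Data.Integer.Properties as ℤ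
import Data.Integer.Solver
open import Data.List.Base using (List; []; _∷_; length; tabulate; _++_; map; filter; upTo; cartesianProduct)
open import Data.List.Membership.Propositional using () renaming (_∈_ to _∈ˡ_)
open import Data.List.Membership.Propositional.Properties using (∈-map⁺; ∈-map⁻; ∈-++⁺ˡ; ∈-++⁺ʳ; ∈-++⁻; ∈-filter⁺; ∈-filter⁻; ∈-upTo⁺; ∈-cartesianProduct⁺)
import Data.List.Properties as List
open import Data.List.Relation.Unary.AllPairs using ([])
open import Data.List.Relation.Unary.Any using (Any; here; there)
import Data.List.Relation.Unary.Any.Properties as Any
open import Data.List.Relation.Unary.Unique.Propositional using (Unique)
import Data.List.Relation.Unary.Unique.Propositional.Properties as Unique
open import Data.Maybe.Base using (Maybe; just; nothing)
open import Data.Nat.Base as ℕ using (ℕ; zero; suc; NonZero)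
import Data.Nat.DivMod as ℕ
open import Data.Nat.ListAction using (sum)
open import Data.Nat.ListAction.Properties using (sum-++)
import Data.Nat.Properties as ℕ
open import Data.Product.Base using (Σ; ∃-syntax; _×_; _,_; proj₁; proj₂)
open import Data.Rational.Unnormalised.Base using (_/_; ceiling)
open import Data.Sign.Base as Sign using (Sign)
open import Data.Sum.Base as Sum using (inj₁; inj₂)
open import Data.Vec.Functional using (insertAt)
open import Data.Vec.Functional.Properties using (insertAt-lookup; insertAt-punchIn)
open import Function.Base using (_∘_; id; const)
open import Function.Bundles using (module Equivalence; mk⇔)
open import Level using (Level; lift)
open import Relation.Binary.Construct.Add.Supremum.NonStrict ℤ._≤_ using (_≤⁺_; [_]; _≤⊤⁺; ≤⁺-trans; ≤⁺-total; [≤]-injective; ≤⁺-reflexive-≡; ≤⁺-dec)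
open import Relation.Binary.PropositionalEquality.Core as ≡ using (_≡_)
open import Relation.Nullary.Construct.Add.Supremum using (⊤⁺; [_]; []-injective)
open import Relation.Nullary.Decidable.Core using (yes; no; decidable-stable; Dec; does)
open import Relation.Nullary.Negation.Core using (¬_; contradiction)
open import Relation.Unary using (Pred; _∈_; _⊆_; _≐_; _∪_)

-- Neither the vanishing degree of principal divisors nor the finiteness of `L D` is taken as known;
-- `HasDim` is a relation, and every dimension used has to be exhibited. The genus supplies the
-- starting point: adding `P` to a divisor that attains the maximum raises the degree by one, so the
-- dimension must rise as well, which yields a nonzero function in a space of known dimension. Once
-- L(-P) = 0, the dimension of each L((k - 1)P) is found by counting pole orders below k.
--
-- The bound 2g comes from a reflection: if M is not a pole order, then i and M - i are never both
-- pole orders, so at least half of the M + 1 numbers from 0 to M are gaps; at most g of them are,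
-- hence M < 2g. In `G k 0` one has s₁ > kπ, so kπ ≥ 2g - 1 already forces s₁ ≥ 2g: this is the 2g -
-- 1 of the summation limit. The factor k + 1 counts the boxes with i + j = k, all of them
-- translates of `G k 0`.

-- Ring solver with integer coefficients.

module IntegerRingSolver {c ℓ} (R : CommutativeRing c ℓ) where
  open CommutativeRing R
  open Algebra.Properties.Ring ring
  open Algebra.Properties.Semiring.Mult semiring renaming (_×_ to _×ᴿ_)
  open import Relation.Binary.Reasoning.Setoid setoid

  private
    ⟦_⟧ᶻ : ℤ → Carrier
    ⟦ + n ⟧ᶻ      = n ×ᴿ 1#
    ⟦ -[1+ n ] ⟧ᶻ = - (suc n ×ᴿ 1#)

    neg-homo : ∀ i → ⟦ ℤ.- i ⟧ᶻ ≈ - ⟦ i ⟧ᶻ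
    neg-homo (+ zero)    = sym -0#≈0#
    neg-homo (+ (suc n)) = refl
    neg-homo -[1+ n ]    = sym (-‿involutive _)

    cancel-+ : ∀ a b c → b - c ≈ (a + b) - (a + c)
    cancel-+ a b c = begin
      b - c                    ≈⟨ +-congʳ (+-identityˡ b) ⟨
      0# + b - c               ≈⟨ +-congʳ (+-congʳ (-‿inverseˡ a)) ⟨
      - a + a + b - c          ≈⟨ +-congʳ (+-assoc _ _ _) ⟩
      - a + (a + b) - c        ≈⟨ +-congʳ (+-comm _ _) ⟩
      (a + b) - a - c          ≈⟨ +-assoc _ _ _ ⟩
      (a + b) + (- a - c)      ≈⟨ +-congˡ (-‿+-comm a c) ⟩
      (a + b) - (a + c)        ∎

    ⊖-homo : ∀ m n → ⟦ m ℤ.⊖ n ⟧ᶻ ≈ m ×ᴿ 1# - n ×ᴿ 1#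
    ⊖-homo m zero = begin
      m ×ᴿ 1#       ≈⟨ +-identityʳ _ ⟨
      m ×ᴿ 1# + 0#  ≈⟨ +-congˡ -0#≈0# ⟨
      m ×ᴿ 1# - 0#  ∎
    ⊖-homo zero (suc n) = sym (+-identityˡ _)
    ⊖-homo (suc m) (suc n) = begin
      ⟦ suc m ℤ.⊖ suc n ⟧ᶻ               ≡⟨ ≡.cong ⟦_⟧ᶻ (ℤ.[1+m]⊖[1+n]≡m⊖n m n) ⟩
      ⟦ m ℤ.⊖ n ⟧ᶻ                       ≈⟨ ⊖-homo m n ⟩
      m ×ᴿ 1# - n ×ᴿ 1#                  ≈⟨ cancel-+ 1# _ _ ⟩
      suc m ×ᴿ 1# - suc n ×ᴿ 1#          ∎

    +-homo : ∀ i j → ⟦ i ℤ.+ j ⟧ᶻ ≈ ⟦ i ⟧ᶻ + ⟦ j ⟧ᶻ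
    +-homo (+ m)    (+ n)    = ×-homo-+ 1# m n
    +-homo (+ m)    -[1+ n ] = ⊖-homo m (suc n)
    +-homo -[1+ m ] (+ n)    = trans (⊖-homo n (suc m)) (+-comm _ _)
    +-homo -[1+ m ] -[1+ n ] = begin
      - (suc (suc (m ℕ.+ n)) ×ᴿ 1#)         ≈⟨ -‿cong (+-congˡ (×-homo-+ 1# (suc m) n)) ⟩
      - (1# + (suc m ×ᴿ 1# + n ×ᴿ 1#))      ≈⟨ -‿cong (+-congˡ (+-comm _ _)) ⟩
      - (1# + (n ×ᴿ 1# + suc m ×ᴿ 1#))      ≈⟨ -‿cong (+-assoc _ _ _) ⟨
      - (suc n ×ᴿ 1# + suc m ×ᴿ 1#)         ≈⟨ -‿anti-homo-+ _ _ ⟩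
      - (suc m ×ᴿ 1#) - suc n ×ᴿ 1#         ∎

    ◃-homo : ∀ n → ⟦ Sign.- ℤ.◃ n ⟧ᶻ ≈ - (n ×ᴿ 1#)
    ◃-homo zero    = sym -0#≈0#
    ◃-homo (suc n) = refl

    *-homo : ∀ i j → ⟦ i ℤ.* j ⟧ᶻ ≈ ⟦ i ⟧ᶻ * ⟦ j ⟧ᶻ
    *-homo (+ m) (+ n) = trans (reflexive (≡.cong ⟦_⟧ᶻ (ℤ.+◃n≡+n (m ℕ.* n)))) (×1-homo-* m n)
    *-homo (+ m) -[1+ n ] = begin
      ⟦ Sign.- ℤ.◃ (m ℕ.* suc n) ⟧ᶻ     ≈⟨ ◃-homo (m ℕ.* suc n) ⟩
      - ((m ℕ.* suc n) ×ᴿ 1#)          ≈⟨ -‿cong (×1-homo-* m (suc n)) ⟩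
      - (m ×ᴿ 1# * suc n ×ᴿ 1#)        ≈⟨ -‿distribʳ-* _ _ ⟩
      m ×ᴿ 1# * - (suc n ×ᴿ 1#)        ∎
    *-homo -[1+ m ] (+ n) = begin
      ⟦ Sign.- ℤ.◃ (suc m ℕ.* n) ⟧ᶻ     ≈⟨ ◃-homo (suc m ℕ.* n) ⟩
      - ((suc m ℕ.* n) ×ᴿ 1#)          ≈⟨ -‿cong (×1-homo-* (suc m) n) ⟩
      - (suc m ×ᴿ 1# * n ×ᴿ 1#)        ≈⟨ -‿distribˡ-* _ _ ⟩
      - (suc m ×ᴿ 1#) * n ×ᴿ 1#        ∎
    *-homo -[1+ m ] -[1+ n ] = begin
      (suc m ℕ.* suc n) ×ᴿ 1#              ≈⟨ ×1-homo-* (suc m) (suc n) ⟩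
      suc m ×ᴿ 1# * suc n ×ᴿ 1#            ≈⟨ -‿involutive _ ⟨
      - - (suc m ×ᴿ 1# * suc n ×ᴿ 1#)      ≈⟨ -‿cong (-‿distribˡ-* _ _) ⟩
      - (- (suc m ×ᴿ 1#) * suc n ×ᴿ 1#)    ≈⟨ -‿distribʳ-* _ _ ⟩
      - (suc m ×ᴿ 1#) * - (suc n ×ᴿ 1#)    ∎

    morphism : ℤ.+-*-rawRing -Raw-AlmostCommutative⟶ fromCommutativeRing R
    morphism = record
      { ⟦_⟧    = ⟦_⟧ᶻ
      ; +-homo = +-homo
      ; *-homo = *-homo
      ; -‿homo = neg-homo
      ; 0-homo = refl
      ; 1-homo = +-identityʳ 1#
      }

    -- Equality of integer coefficients is decidable although equality in `R` need not be; this is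
    -- what lets normal forms cancel terms such as `x - x`.
    _coeff≟_ : ∀ i j → Maybe (⟦ i ⟧ᶻ ≈ ⟦ j ⟧ᶻ)
    i coeff≟ j with i ℤ.≟ j
    ... | yes i≡j = just (reflexive (≡.cong ⟦_⟧ᶻ i≡j))
    ... | no  _   = nothing

  open Algebra.Solver.Ring ℤ.+-*-rawRing (fromCommutativeRing R) morphism _coeff≟_ public
    using (solve; _:=_; _:+_; _:*_; _:-_; :-_; con)

-- Field arithmetic and linear systems over a subfield.

module FieldProperties {ℓ} (em : ExcludedMiddle ℓ) (F : HeytingField ℓ ℓ ℓ) where
  open Field F public
  open HeytingField F using (_#_; tight; #⇒invertible; invertible⇒#; #-irrefl)
  open CommutativeRing commutativeRing public
    hiding (Carrier; _≈_; _+_; _*_; -_; _-_; 0#; 1#; rawRing; _≉_; zero)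
  open Algebra.Properties.Ring ring public
  open Algebra.Properties.Semiring.Sum semiring public
    using (sum-cong-≋; ∑-distrib-+; ∑-comm; sum-remove; *-distribˡ-sum; *-distribʳ-sum; sum-replicate-zero)
  open Algebra.Properties.Semiring.Exp semiring public using (_^_)
  open IntegerRingSolver commutativeRing public
  open import Relation.Binary.Reasoning.Setoid setoid

  x-0≈x : ∀ x → x - 0# ≈ x
  x-0≈x x = trans (+-congˡ -0#≈0#) (+-identityʳ x)

  -- A Heyting field inverts elements apart from zero. By tightness, failing to be apart from zero
  -- would mean being zero; the inverse supplied is that of `x - 0#`.
  ≉0⇒invertible : ∀ {x} → x ≉ 0# → ∃[ y ] x * y ≈ 1#
  ≉0⇒invertible {x} x≉0 with em {x # 0#}
  ... | no ¬x#0 = contradiction (proj₁ (tight x 0#) ¬x#0) x≉0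
  ... | yes x#0 with #⇒invertible x#0
  ...   | y , _ , xy≈1 = y , trans (*-congʳ (sym (x-0≈x x))) xy≈1

  1≉0 : 1# ≉ 0#
  1≉0 1≈0 = #-irrefl 1≈0 (invertible⇒# (1# , 1*[1-0]≈1 , trans (*-comm _ _) 1*[1-0]≈1))
    where
    1*[1-0]≈1 : 1# * (1# - 0#) ≈ 1#
    1*[1-0]≈1 = trans (*-identityˡ _) (x-0≈x 1#)

  *-cancelˡ-≈0 : ∀ {x y} → x ≉ 0# → x * y ≈ 0# → y ≈ 0#
  *-cancelˡ-≈0 {x} {y} x≉0 xy≈0 with ≉0⇒invertible x≉0
  ... | z , xz≈1 = begin
    y            ≈⟨ *-identityˡ y ⟨
    1# * y       ≈⟨ *-congʳ xz≈1 ⟨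
    x * z * y    ≈⟨ solve 3 (λ x y z → x :* z :* y := z :* (x :* y)) refl x y z ⟩
    z * (x * y)  ≈⟨ *-congˡ xy≈0 ⟩
    z * 0#       ≈⟨ zeroʳ z ⟩
    0#           ∎

  *-≉0 : ∀ {x y} → x ≉ 0# → y ≉ 0# → x * y ≉ 0#
  *-≉0 x≉0 y≉0 xy≈0 = y≉0 (*-cancelˡ-≈0 x≉0 xy≈0)

  inverse-≉0 : ∀ {x y} → x * y ≈ 1# → x ≉ 0#
  inverse-≉0 xy≈1 x≈0 = 1≉0 (trans (sym xy≈1) (trans (*-congʳ x≈0) (zeroˡ _)))

  ∑-zero : ∀ {n} (f : Fin n → Carrier) → (∀ i → f i ≈ 0#) → ∑ f ≈ 0#
  ∑-zero {n} f f≈0 = trans (sum-cong-≋ f≈0) (sum-replicate-zero n)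

  ∑-cong : ∀ {n} (f g : Fin n → Carrier) → (∀ i → f i ≈ g i) → ∑ f ≈ ∑ g
  ∑-cong f g f≈g = sum-cong-≋ f≈g

  ∑-*-assoc : ∀ {m n} (c : Fin m → Carrier) (a : Fin m → Fin n → Carrier) (y : Fin n → Carrier) →
    ∑ (λ j → c j * ∑ (λ i → a j i * y i)) ≈ ∑ (λ i → ∑ (λ j → c j * a j i) * y i)
  ∑-*-assoc c a y = begin
    ∑ (λ j → c j * ∑ (λ i → a j i * y i))    ≈⟨ sum-cong-≋ (λ j → *-distribˡ-sum (c j) (λ i → a j i * y i)) ⟩
    ∑ (λ j → ∑ (λ i → c j * (a j i * y i)))  ≈⟨ ∑-comm (λ j i → c j * (a j i * y i)) ⟩
    ∑ (λ i → ∑ (λ j → c j * (a j i * y i)))  ≈⟨ sum-cong-≋ (λ i → sum-cong-≋ (λ j → *-assoc (c j) (a j i) (y i))) ⟨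
    ∑ (λ i → ∑ (λ j → c j * a j i * y i))    ≈⟨ sum-cong-≋ (λ i → *-distribʳ-sum (y i) (λ j → c j * a j i)) ⟨
    ∑ (λ i → ∑ (λ j → c j * a j i) * y i)    ∎

  -- One row operation: `y` is the pivot row, `r` the inverse of the pivot, `x` the row being
  -- cleared and `a` its entry in the pivot column.
  ∑-eliminate : ∀ {n} (c x y : Fin n → Carrier) a r →
    ∑ (λ j → c j * x j) + ∑ (λ j → c j * y j) * (- (a * r)) ≈ ∑ (λ j → c j * (x j - a * (r * y j)))
  ∑-eliminate c x y a r = begin
    ∑ (λ j → c j * x j) + ∑ (λ j → c j * y j) * (- (a * r))    ≈⟨ +-congˡ (*-distribʳ-sum (- (a * r)) (λ j → c j * y j)) ⟩
    ∑ (λ j → c j * x j) + ∑ (λ j → c j * y j * (- (a * r)))    ≈⟨ ∑-distrib-+ (λ j → c j * x j) (λ j → c j * y j * (- (a * r))) ⟨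
    ∑ (λ j → c j * x j + c j * y j * (- (a * r)))
      ≈⟨ sum-cong-≋ (λ j → solve 5 (λ c x y a r → c :* x :+ c :* y :* (:- (a :* r)) := c :* (x :- a :* (r :* y)))
                            refl (c j) (x j) (y j) a r) ⟩
    ∑ (λ j → c j * (x j - a * (r * y j)))                      ∎

  -- Linear algebra takes place over subfields of one field, so that a single elimination serves
  -- both K(x) and the image of `K` in `F`.
  record IsSubfield (S : Pred Carrier ℓ) : Set ℓ where
    field
      resp     : ∀ {x y} → x ≈ y → x ∈ S → y ∈ S
      0∈       : 0# ∈ S
      1∈       : 1# ∈ S
      +-closed : ∀ {x y} → x ∈ S → y ∈ S → x + y ∈ S
      *-closed : ∀ {x y} → x ∈ S → y ∈ S → x * y ∈ S
      -closed  : ∀ {x} → x ∈ S → - x ∈ S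
      ⁻¹closed : ∀ {x y} → x ∈ S → x * y ≈ 1# → y ∈ S

    ∑-closed : ∀ {n} (f : Fin n → Carrier) → (∀ i → f i ∈ S) → ∑ f ∈ S
    ∑-closed {zero}  f f∈ = 0∈
    ∑-closed {suc n} f f∈ = +-closed (f∈ zero) (∑-closed (f ∘ suc) (f∈ ∘ suc))

  module Subfield {S : Pred Carrier ℓ} (isSubfield : IsSubfield S) where
    open IsSubfield isSubfield

    -- Gaussian elimination: clear the first equation with a pivot, or drop it
    -- and one unknown when all of its coefficients vanish.
    homogeneousSystem : ∀ {n} (A : Fin n → Fin (suc n) → Carrier) → (∀ i j → A i j ∈ S) →
      Σ (Fin (suc n) → Carrier) λ c → (∀ j → c j ∈ S) × (∃[ j ] c j ≉ 0#) × (∀ i → ∑ (λ j → c j * A i j) ≈ 0#)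
    homogeneousSystem {zero} A A∈ = (λ _ → 1#) , (λ _ → 1∈) , (zero , 1≉0) , λ ()
    homogeneousSystem {suc n} A A∈ with em {∃[ p ] A zero p ≉ 0#}
    ... | no row≈0
        with homogeneousSystem (λ i j → A (suc i) (suc j)) (λ i j → A∈ (suc i) (suc j))
    ...   | c , c∈ , (k , ck≉0) , sol = c′ , c′∈ , (suc k , ck≉0) , sol′
      where
      c′ : Fin (suc (suc n)) → Carrier
      c′ zero    = 0#
      c′ (suc j) = c j

      c′∈ : ∀ j → c′ j ∈ S
      c′∈ zero    = 0∈
      c′∈ (suc j) = c∈ j

      sol′ : ∀ i → ∑ (λ j → c′ j * A i j) ≈ 0#
      sol′ zero    = ∑-zero (λ j → c′ j * A zero j) λ j →
        trans (*-congˡ (decidable-stable em λ Aj≉0 → row≈0 (j , Aj≉0))) (zeroʳ _)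
      sol′ (suc i) = trans (+-cong (zeroˡ _) (sol i)) (+-identityˡ _)
    homogeneousSystem {suc n} A A∈ | yes (p , pivot≉0)
        with ≉0⇒invertible pivot≉0
    ... | r , pr≈1 with homogeneousSystem B B∈
      where
      B : Fin n → Fin (suc n) → Carrier
      B i j = A (suc i) (punchIn p j) - A (suc i) p * (r * A zero (punchIn p j))

      B∈ : ∀ i j → B i j ∈ S
      B∈ i j = +-closed (A∈ _ _) (-closed (*-closed (A∈ _ _) (*-closed (⁻¹closed (A∈ _ _) pr≈1) (A∈ _ _))))
    ...   | c , c∈ , (k , ck≉0) , sol =
      c′ , c′∈ , (punchIn p k , λ ≈0 → ck≉0 (trans (reflexive (≡.sym (insertAt-punchIn c p cp k))) ≈0)) , sol′
      where
      -- The pivot equation solved for the pivot unknown.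
      cp : Carrier
      cp = - (r * ∑ λ j → c j * A zero (punchIn p j))

      cp∈ : cp ∈ S
      cp∈ = -closed (*-closed (⁻¹closed (A∈ _ _) pr≈1) (∑-closed (λ j → c j * A zero (punchIn p j)) λ j → *-closed (c∈ j) (A∈ _ _)))

      c′ : Fin (suc (suc n)) → Carrier
      c′ = insertAt c p cp

      c′∈ : ∀ j → c′ j ∈ S
      c′∈ j with p Fin.≟ j
      ... | yes ≡.refl = resp (reflexive (≡.sym (insertAt-lookup c p cp))) cp∈
      ... | no  p≢j    = ≡.subst (λ j → c′ j ∈ S) (Fin.punchIn-punchOut p≢j)
        (resp (reflexive (≡.sym (insertAt-punchIn c p cp _))) (c∈ _))

      expand : ∀ i → ∑ (λ j → c′ j * A i j) ≈ cp * A i p + ∑ (λ j → c j * A i (punchIn p j))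
      expand i = trans (sum-remove {i = p} (λ j → c′ j * A i j)) (+-cong
        (*-congʳ (reflexive (insertAt-lookup c p cp)))
        (∑-cong (λ j → c′ (punchIn p j) * A i (punchIn p j)) (λ j → c j * A i (punchIn p j))
          λ j → *-congʳ (reflexive (insertAt-punchIn c p cp j))))

      s : Carrier
      s = ∑ λ j → c j * A zero (punchIn p j)

      sol′ : ∀ i → ∑ (λ j → c′ j * A i j) ≈ 0#
      sol′ zero = begin
        ∑ (λ j → c′ j * A zero j)  ≈⟨ expand zero ⟩
        - (r * s) * A zero p + s    ≈⟨ solve 3 (λ r s a → :- (r :* s) :* a :+ s := s :- a :* r :* s) refl r s (A zero p) ⟩
        s - A zero p * r * s        ≈⟨ +-congˡ (-‿cong (trans (*-congʳ pr≈1) (*-identityˡ s))) ⟩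
        s - s                       ≈⟨ -‿inverseʳ s ⟩
        0#                          ∎
      sol′ (suc i) = begin
        ∑ (λ j → c′ j * A (suc i) j)  ≈⟨ expand (suc i) ⟩
        - (r * s) * a + t              ≈⟨ solve 4 (λ r s a t → :- (r :* s) :* a :+ t := t :+ s :* (:- (a :* r))) refl r s a t ⟩
        t + s * (- (a * r))            ≈⟨ ∑-eliminate c (λ j → A (suc i) (punchIn p j)) (λ j → A zero (punchIn p j)) a r ⟩
        _                              ≈⟨ sol i ⟩
        0#                             ∎
        where
        a t : Carrier
        a = A (suc i) p
        t = ∑ λ j → c j * A (suc i) (punchIn p j)

    -- Written in coordinates, a relation among the `z j` amounts to n homogeneous equations in n +
    -- 1 unknowns.
    span-dependent : ∀ {n} (y : Fin n → Carrier) (z : Fin (suc n) → Carrier) →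
      (∀ j → Σ (Fin n → Carrier) λ a → (∀ i → a i ∈ S) × z j ≈ ∑ (λ i → a i * y i)) →
      Σ (Fin (suc n) → Carrier) λ c → (∀ j → c j ∈ S) × (∃[ j ] c j ≉ 0#) × ∑ (λ j → c j * z j) ≈ 0#
    span-dependent {n} y z z∈span
        with homogeneousSystem (λ i j → proj₁ (z∈span j) i) (λ i j → proj₁ (proj₂ (z∈span j)) i)
    ... | c , c∈ , c≉0 , sol = c , c∈ , c≉0 , (begin
      ∑ (λ j → c j * z j)                    ≈⟨ ∑-cong (λ j → c j * z j) (λ j → c j * ∑ (λ i → a j i * y i))
                                                  (λ j → *-congˡ (proj₂ (proj₂ (z∈span j)))) ⟩
      ∑ (λ j → c j * ∑ (λ i → a j i * y i))  ≈⟨ ∑-*-assoc c a y ⟩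
      ∑ (λ i → ∑ (λ j → c j * a j i) * y i)  ≈⟨ ∑-zero _ (λ i → trans (*-congʳ (sol i)) (zeroˡ (y i))) ⟩
      0#                                     ∎)
      where
      a : Fin (suc n) → Fin n → Carrier
      a j = proj₁ (z∈span j)

-- Polynomials over `K` evaluated in `F`, and the subfield K(x).

module FieldExtension {ℓ} (em : ExcludedMiddle ℓ) (K F : HeytingField ℓ ℓ ℓ)
         (ι : Field.Carrier K → Field.Carrier F) (isHom : IsFieldHom K F ι) where
  module K = FieldProperties em K
  open FieldProperties em F public
  open RingMorphisms.IsRingHomomorphism isHom public
    using () renaming (⟦⟧-cong to ι-cong; +-homo to ι-+; *-homo to ι-*; 0#-homo to ι-0; 1#-homo to ι-1; -‿homo to ι-neg)
  open Polynomial K F ι public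
  open Polynomial K K id using () renaming (eval to evalᴷ)
  open import Relation.Binary.Reasoning.Setoid setoid

  ι-≉0 : ∀ {a} → a K.≉ K.0# → ι a ≉ 0#
  ι-≉0 {a} a≉0 ιa≈0 with K.≉0⇒invertible a≉0
  ... | b , ab≈1 = inverse-≉0 (trans (sym (ι-* a b)) (trans (ι-cong ab≈1) ι-1)) ιa≈0

  ι-injective₀ : ∀ {a} → ι a ≈ 0# → a K.≈ K.0#
  ι-injective₀ ιa≈0 = decidable-stable em λ a≉0 → ι-≉0 a≉0 ιa≈0

  ι-inverse : ∀ {a b} → a K.* b K.≈ K.1# → ι a * ι b ≈ 1#
  ι-inverse ab≈1 = trans (sym (ι-* _ _)) (trans (ι-cong ab≈1) ι-1)

  ιK : Pred Carrier ℓ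
  ιK z = ∃[ a ] ι a ≈ z

  ιK-isSubfield : IsSubfield ιK
  ιK-isSubfield = record
    { resp     = λ { x≈y (a , ≈x) → a , trans ≈x x≈y }
    ; 0∈       = K.0# , ι-0
    ; 1∈       = K.1# , ι-1
    ; +-closed = λ { (a , ≈x) (b , ≈y) → a K.+ b , trans (ι-+ a b) (+-cong ≈x ≈y) }
    ; *-closed = λ { (a , ≈x) (b , ≈y) → a K.* b , trans (ι-* a b) (*-cong ≈x ≈y) }
    ; -closed  = λ { (a , ≈x) → K.- a , trans (ι-neg a) (-‿cong ≈x) }
    ; ⁻¹closed = inverse
    }
    where
    inverse : ∀ {x y} → x ∈ ιK → x * y ≈ 1# → y ∈ ιK
    inverse {x} {y} (a , ιa≈x) xy≈1 = b , (begin
      ι b            ≈⟨ *-identityʳ _ ⟨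
      ι b * 1#       ≈⟨ *-congˡ xy≈1 ⟨
      ι b * (x * y)  ≈⟨ solve 3 (λ b x y → b :* (x :* y) := x :* b :* y) refl (ι b) x y ⟩
      x * ι b * y    ≈⟨ *-congʳ (*-congʳ ιa≈x) ⟨
      ι a * ι b * y  ≈⟨ *-congʳ (ι-inverse ab≈1) ⟩
      1# * y         ≈⟨ *-identityˡ y ⟩
      y              ∎)
      where
      a≉0 : a K.≉ K.0#
      a≉0 a≈0 = inverse-≉0 xy≈1 (trans (sym ιa≈x) (trans (ι-cong a≈0) ι-0))
      b    = proj₁ (K.≉0⇒invertible a≉0)
      ab≈1 = proj₂ (K.≉0⇒invertible a≉0)

  eval-zero : ∀ p → ¬ Any (K._≉ K.0#) p → ∀ y → eval p y ≈ 0#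
  eval-zero []       p≈0 y = refl
  eval-zero (a ∷ as) p≈0 y = begin
    ι a + y * eval as y  ≈⟨ +-cong (trans (ι-cong (decidable-stable em λ a≉0 → p≈0 (here a≉0))) ι-0)
                                   (*-congˡ (eval-zero as (p≈0 ∘ there) y)) ⟩
    0# + y * 0#          ≈⟨ trans (+-identityˡ _) (zeroʳ y) ⟩
    0#                   ∎

  eval-≉0 : ∀ {p y} → eval p y ≉ 0# → Any (K._≉ K.0#) p
  eval-≉0 {p} {y} ≉0 = decidable-stable em λ p≈0 → ≉0 (eval-zero p p≈0 y)

  -- Only the values of a polynomial matter, and trailing zeros make its list of coefficients
  -- ambiguous; sums, multiples and products are therefore given as lists with prescribed values at
  -- every `y`.
  eval-+ : ∀ p r → ∃[ s ] (∀ y → eval s y ≈ eval p y + eval r y)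
  eval-+ []       r        = r , λ y → sym (+-identityˡ _)
  eval-+ (a ∷ as) []       = a ∷ as , λ y → sym (+-identityʳ _)
  eval-+ (a ∷ as) (b ∷ bs) with eval-+ as bs
  ... | s , eq = (a K.+ b) ∷ s , λ y → begin
    ι (a K.+ b) + y * eval s y                     ≈⟨ +-cong (ι-+ a b) (*-congˡ (eq y)) ⟩
    ι a + ι b + y * (eval as y + eval bs y)        ≈⟨ solve 5 (λ a b y p r → a :+ b :+ y :* (p :+ r) := a :+ y :* p :+ (b :+ y :* r))
                                                        refl (ι a) (ι b) y (eval as y) (eval bs y) ⟩
    ι a + y * eval as y + (ι b + y * eval bs y)    ∎

  eval-scale : ∀ a p → ∃[ s ] (∀ y → eval s y ≈ ι a * eval p y)
  eval-scale a []       = [] , λ y → sym (zeroʳ _)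
  eval-scale a (b ∷ bs) with eval-scale a bs
  ... | s , eq = (a K.* b) ∷ s , λ y → begin
    ι (a K.* b) + y * eval s y             ≈⟨ +-cong (ι-* a b) (*-congˡ (eq y)) ⟩
    ι a * ι b + y * (ι a * eval bs y)      ≈⟨ solve 4 (λ a b y p → a :* b :+ y :* (a :* p) := a :* (b :+ y :* p))
                                                refl (ι a) (ι b) y (eval bs y) ⟩
    ι a * (ι b + y * eval bs y)            ∎

  eval-* : ∀ p r → ∃[ s ] (∀ y → eval s y ≈ eval p y * eval r y)
  eval-* []       r = [] , λ y → sym (zeroˡ _)
  eval-* (a ∷ as) r with eval-* as r | eval-scale a r
  ... | s , eq | t , eq′ with eval-+ t (K.0# ∷ s)
  ...   | u , eq″ = u , λ y → begin
    eval u y                                        ≈⟨ eq″ y ⟩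
    eval t y + (ι K.0# + y * eval s y)              ≈⟨ +-cong (eq′ y) (+-cong ι-0 (*-congˡ (eq y))) ⟩
    ι a * eval r y + (0# + y * (eval as y * eval r y))
      ≈⟨ solve 4 (λ a r y p → a :* r :+ (con (+ 0) :+ y :* (p :* r)) := (a :+ y :* p) :* r) refl (ι a) (eval r y) y (eval as y) ⟩
    (ι a + y * eval as y) * eval r y                ∎

  constant : ∀ a y → eval (a ∷ []) y ≈ ι a
  constant a y = trans (+-congˡ (zeroʳ y)) (+-identityʳ _)

  k⟨⟩-isSubfield : ∀ x → IsSubfield (_∈k⟨ x ⟩)
  k⟨⟩-isSubfield x = record
    { resp     = λ { x≈y (p , r , r≉0 , eq) → p , r , r≉0 , trans (*-congʳ (sym x≈y)) eq }
    ; 0∈       = [] , one , one≉0 , zeroˡ _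
    ; 1∈       = one , one , one≉0 , *-identityˡ _
    ; +-closed = plus
    ; *-closed = times
    ; -closed  = negate
    ; ⁻¹closed = inverse
    }
    where
    one : List K.Carrier
    one = K.1# ∷ []

    one≉0 : eval one x ≉ 0#
    one≉0 ≈0 = 1≉0 (trans (sym (trans (constant K.1# x) ι-1)) ≈0)

    plus : ∀ {z w} → z ∈k⟨ x ⟩ → w ∈k⟨ x ⟩ → (z + w) ∈k⟨ x ⟩
    plus {z} {w} (p , r , r≉0 , eq) (p′ , r′ , r′≉0 , eq′) = num , den , den≉0 , (begin
      (z + w) * eval den x                                     ≈⟨ *-congˡ (deneq x) ⟩
      (z + w) * (eval r x * eval r′ x)                         ≈⟨ solve 4 (λ z w r r′ → (z :+ w) :* (r :* r′) := z :* r :* r′ :+ w :* r′ :* r)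
                                                                    refl z w (eval r x) (eval r′ x) ⟩
      z * eval r x * eval r′ x + w * eval r′ x * eval r x      ≈⟨ +-cong (*-congʳ eq) (*-congʳ eq′) ⟩
      eval p x * eval r′ x + eval p′ x * eval r x              ≈⟨ +-cong (proj₂ (eval-* p r′) x) (proj₂ (eval-* p′ r) x) ⟨
      eval (proj₁ (eval-* p r′)) x + eval (proj₁ (eval-* p′ r)) x  ≈⟨ proj₂ (eval-+ (proj₁ (eval-* p r′)) (proj₁ (eval-* p′ r))) x ⟨
      eval num x                                               ∎)
      where
      den   = proj₁ (eval-* r r′)
      deneq = proj₂ (eval-* r r′)
      num   = proj₁ (eval-+ (proj₁ (eval-* p r′)) (proj₁ (eval-* p′ r)))
      den≉0 : eval den x ≉ 0#
      den≉0 ≈0 = *-≉0 r≉0 r′≉0 (trans (sym (deneq x)) ≈0)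

    times : ∀ {z w} → z ∈k⟨ x ⟩ → w ∈k⟨ x ⟩ → (z * w) ∈k⟨ x ⟩
    times {z} {w} (p , r , r≉0 , eq) (p′ , r′ , r′≉0 , eq′) = num , den , den≉0 , (begin
      z * w * eval den x                   ≈⟨ *-congˡ (deneq x) ⟩
      z * w * (eval r x * eval r′ x)       ≈⟨ solve 4 (λ z w r r′ → z :* w :* (r :* r′) := z :* r :* (w :* r′))
                                                refl z w (eval r x) (eval r′ x) ⟩
      z * eval r x * (w * eval r′ x)       ≈⟨ *-cong eq eq′ ⟩
      eval p x * eval p′ x                 ≈⟨ proj₂ (eval-* p p′) x ⟨
      eval num x                           ∎)
      where
      den   = proj₁ (eval-* r r′)
      deneq = proj₂ (eval-* r r′)
      num   = proj₁ (eval-* p p′)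
      den≉0 : eval den x ≉ 0#
      den≉0 ≈0 = *-≉0 r≉0 r′≉0 (trans (sym (deneq x)) ≈0)

    negate : ∀ {z} → z ∈k⟨ x ⟩ → (- z) ∈k⟨ x ⟩
    negate {z} (p , r , r≉0 , eq) = proj₁ (eval-scale (K.- K.1#) p) , r , r≉0 , (begin
      - z * eval r x          ≈⟨ -‿distribˡ-* z _ ⟨
      - (z * eval r x)        ≈⟨ -‿cong eq ⟩
      - eval p x              ≈⟨ -1*x≈-x _ ⟨
      - 1# * eval p x         ≈⟨ *-congʳ (-‿cong ι-1) ⟨
      - ι K.1# * eval p x     ≈⟨ *-congʳ (ι-neg K.1#) ⟨
      ι (K.- K.1#) * eval p x ≈⟨ proj₂ (eval-scale (K.- K.1#) p) x ⟨
      _                       ∎)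

    inverse : ∀ {z w} → z ∈k⟨ x ⟩ → z * w ≈ 1# → w ∈k⟨ x ⟩
    inverse {z} {w} (p , r , r≉0 , eq) zw≈1 = r , p , p≉0 , (begin
      w * eval p x        ≈⟨ *-congˡ eq ⟨
      w * (z * eval r x)  ≈⟨ solve 3 (λ w z r → w :* (z :* r) := z :* w :* r) refl w z (eval r x) ⟩
      z * w * eval r x    ≈⟨ *-congʳ zw≈1 ⟩
      1# * eval r x       ≈⟨ *-identityˡ _ ⟩
      eval r x            ∎)
      where
      p≉0 : eval p x ≉ 0#
      p≉0 p≈0 = *-≉0 (inverse-≉0 zw≈1) r≉0 (trans eq p≈0)

  -- Horner's scheme: the coefficients of the quotient by y - r are the values at `r` of the
  -- successive tails. The constant term of the dividend enters only the remainder, so the argument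
  -- is the tail of the dividend, and the quotient is shorter than the dividend.
  syntheticQuotient : K.Carrier → List K.Carrier → List K.Carrier
  syntheticQuotient r []       = []
  syntheticQuotient r (b ∷ bs) = evalᴷ (b ∷ bs) r ∷ syntheticQuotient r bs

  length-syntheticQuotient : ∀ r as → length (syntheticQuotient r as) ≡ length as
  length-syntheticQuotient r []       = ≡.refl
  length-syntheticQuotient r (b ∷ bs) = ≡.cong suc (length-syntheticQuotient r bs)

  syntheticDivision : ∀ r a as y →
    eval (a ∷ as) y ≈ (y - ι r) * eval (syntheticQuotient r as) y + ι (evalᴷ (a ∷ as) r)
  syntheticDivision r a [] y = begin
    ι a + y * 0#                          ≈⟨ solve 3 (λ a y r → a :+ y :* con (+ 0) := (y :- r) :* con (+ 0) :+ (a :+ r :* con (+ 0)))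
                                               refl (ι a) y (ι r) ⟩
    (y - ι r) * 0# + (ι a + ι r * 0#)     ≈⟨ +-congˡ (+-congˡ (*-congˡ ι-0)) ⟨
    (y - ι r) * 0# + (ι a + ι r * ι K.0#) ≈⟨ +-congˡ (+-congˡ (ι-* _ _)) ⟨
    (y - ι r) * 0# + (ι a + ι (r K.* K.0#)) ≈⟨ +-congˡ (ι-+ _ _) ⟨
    (y - ι r) * 0# + ι (a K.+ r K.* K.0#) ∎
  syntheticDivision r a (b ∷ bs) y = begin
    ι a + y * eval (b ∷ bs) y                    ≈⟨ +-congˡ (*-congˡ (syntheticDivision r b bs y)) ⟩
    ι a + y * ((y - ι r) * q + ι e)              ≈⟨ solve 5 (λ a y r q e → a :+ y :* ((y :- r) :* q :+ e) := (y :- r) :* (e :+ y :* q) :+ (a :+ r :* e))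
                                                      refl (ι a) y (ι r) q (ι e) ⟩
    (y - ι r) * (ι e + y * q) + (ι a + ι r * ι e)    ≈⟨ +-congˡ (trans (ι-+ _ _) (+-congˡ (ι-* _ _))) ⟨
    (y - ι r) * (ι e + y * q) + ι (a K.+ r K.* e)    ∎
    where
    q = eval (syntheticQuotient r bs) y
    e = evalᴷ (b ∷ bs) r

  module AlgebraicallyClosed (closed : IsAlgebraicallyClosed K) {x} (transcendental : Transcendental x) where

    -- Induction along the factorisation of p into linear factors.  That the
    -- quotients stay nonzero is read off from their values at x.
    factorisation : ∀ {q} (Q : Pred Carrier q) (y : Carrier) →
      (∀ {z w} → z ≈ w → z ∈ Q → w ∈ Q) →
      (∀ {z w} → z ∈ Q → w ∈ Q → z * w ∈ Q) →
      (∀ {a} → a K.≉ K.0# → ι a ∈ Q) →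
      (∀ r → y - ι r ∈ Q) →
      ∀ p → Any (K._≉ K.0#) p → eval p y ∈ Q
    factorisation Q y resp mult const linear p = go (length p) p ≡.refl
      where
      go : ∀ n p → length p ≡ n → Any (K._≉ K.0#) p → eval p y ∈ Q
      go zero [] _ ()
      go (suc n) (a ∷ as) len p≉0 with em {Any (K._≉ K.0#) as}
      ... | no as≈0 = resp
        (sym (trans (+-congˡ (trans (*-congˡ (eval-zero as as≈0 y)) (zeroʳ y))) (+-identityʳ _)))
        (const (head≉0 p≉0))
        where
        head≉0 : Any (K._≉ K.0#) (a ∷ as) → a K.≉ K.0#
        head≉0 (here a≉0)   = a≉0
        head≉0 (there as≉0) = contradiction as≉0 as≈0
      ... | yes as≉0 with closed a as as≉0
      ...   | r , root = resp (sym (divides y))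
        (mult (linear r) (go n quotient (≡.trans (length-syntheticQuotient r as) (ℕ.suc-injective len)) quotient≉0))
        where
        quotient : List K.Carrier
        quotient = syntheticQuotient r as

        divides : ∀ y → eval (a ∷ as) y ≈ (y - ι r) * eval quotient y
        divides y = begin
          eval (a ∷ as) y                                          ≈⟨ syntheticDivision r a as y ⟩
          (y - ι r) * eval quotient y + ι (evalᴷ (a ∷ as) r)       ≈⟨ +-congˡ (trans (ι-cong root) ι-0) ⟩
          (y - ι r) * eval quotient y + 0#                         ≈⟨ +-identityʳ _ ⟩
          (y - ι r) * eval quotient y                              ∎

        quotient≉0 : Any (K._≉ K.0#) quotient
        quotient≉0 = decidable-stable em λ q≈0 → transcendental
          (a ∷ as , p≉0 , trans (divides x) (trans (*-congˡ (eval-zero quotient q≈0 x)) (zeroʳ _)))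

-- Order and addition on the integers with infinity.

≤∞-trans : ∀ {k l m} → k ≤⁺ l → l ≤⁺ m → k ≤⁺ m
≤∞-trans = ≤⁺-trans ℤ.≤-trans

≤∞-reflexive : ∀ {k l} → k ≡ l → k ≤⁺ l
≤∞-reflexive = ≤⁺-reflexive-≡ ℤ.≤-reflexive

⊓∞-glb : ∀ {k l m} → k ≤⁺ l → k ≤⁺ m → k ≤⁺ (l ⊓∞ m)
⊓∞-glb [ p ]     [ q ]     = [ ℤ.⊓-glb p q ]
⊓∞-glb [ p ]     (_ ≤⊤⁺)   = [ p ]
⊓∞-glb (_ ≤⊤⁺)   q         = q

+∞-mono-≤ : ∀ {m n k l} → [ m ] ≤⁺ k → [ n ] ≤⁺ l → [ m ℤ.+ n ] ≤⁺ (k +∞ l)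
+∞-mono-≤ [ p ]   [ q ]   = [ ℤ.+-mono-≤ p q ]
+∞-mono-≤ [ p ]   (_ ≤⊤⁺) = _ ≤⊤⁺
+∞-mono-≤ (_ ≤⊤⁺) q       = _ ≤⊤⁺

+∞-identityˡ : ∀ k → [ ℤ.0ℤ ] +∞ k ≡ k
+∞-identityˡ [ m ] = ≡.cong [_] (ℤ.+-identityˡ m)
+∞-identityˡ ⊤⁺    = ≡.refl

≰0⇒≤-1 : ∀ {m} → ¬ ([ ℤ.0ℤ ] ≤⁺ [ m ]) → ℤ.1ℤ ℤ.≤ ℤ.- m
≰0⇒≤-1 {+ m}      0≰m = contradiction [ ℤ.+≤+ ℕ.z≤n ] 0≰m
≰0⇒≤-1 { -[1+ m ]} _  = ℤ.+≤+ (ℕ.s≤s ℕ.z≤n)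

≤≱suc⇒≡ : ∀ {m k} → [ m ] ≤⁺ k → ¬ ([ ℤ.suc m ] ≤⁺ k) → k ≡ [ m ]
≤≱suc⇒≡ [ m≤n ] suc≰n = ≡.cong [_] (ℤ.≤-antisym (ℤ.≮⇒≥ λ m<n → suc≰n [ ℤ.i<j⇒suc[i]≤j m<n ]) m≤n)
≤≱suc⇒≡ (_ ≤⊤⁺) suc≰∞ = contradiction (_ ≤⊤⁺) suc≰∞

1≰0 : ¬ ([ ℤ.1ℤ ] ≤⁺ [ ℤ.0ℤ ])
1≰0 [ ℤ.+≤+ () ]

minimum : ∀ {n} (f : Fin (suc n) → ℤ∞) → ∃[ k ] (∀ i → f k ≤⁺ f i)
minimum {zero} f = zero , λ { zero → ≤∞-reflexive ≡.refl }
minimum {suc n} f with minimum (f ∘ suc)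
... | k , min with ≤⁺-total ℤ.≤-total (f zero) (f (suc k))
...   | inj₁ f0≤fk = zero , λ { zero → ≤∞-reflexive ≡.refl ; (suc i) → ≤∞-trans f0≤fk (min i) }
...   | inj₂ fk≤f0 = suc k , λ { zero → fk≤f0 ; (suc i) → min i }

module ℤ-Group = Algebra.Properties.AbelianGroup ℤ.+-0-abelianGroup

-- The valuation and the residues at a single place.

module Valuation {ℓ} (em : ExcludedMiddle ℓ) (K F : HeytingField ℓ ℓ ℓ)
         (ι : Field.Carrier K → Field.Carrier F) (isHom : IsFieldHom K F ι)
         (P : FunctionField.Place em K F ι) where
  open FieldExtension em K F ι isHom
  open FunctionField.Place P
  open import Relation.Binary.Reasoning.Setoid setoid

  infix 4 _≤v_
  _≤v_ : ℤ → Carrier → Set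
  n ≤v z = [ n ] ≤⁺ v z

  ≤v-resp : ∀ {n z w} → z ≈ w → n ≤v z → n ≤v w
  ≤v-resp z≈w n≤z = ≡.subst (_ ≤⁺_) (v-cong z≈w) n≤z

  ≤v-weaken : ∀ {m n z} → m ℤ.≤ n → n ≤v z → m ≤v z
  ≤v-weaken m≤n n≤z = ≤∞-trans [ m≤n ] n≤z

  ≤v-≡ : ∀ {m n z} → m ℤ.≤ n → v z ≡ [ n ] → m ≤v z
  ≤v-≡ m≤n v≡n = ≤∞-trans [ m≤n ] (≤∞-reflexive (≡.sym v≡n))

  v-zero : ∀ {z} → z ≈ 0# → v z ≡ ⊤⁺
  v-zero {z} = Equivalence.from (v≡∞⇔x≈0 z)

  ≤v-zero : ∀ {n z} → z ≈ 0# → n ≤v z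
  ≤v-zero {n} z≈0 = ≡.subst ([ n ] ≤⁺_) (≡.sym (v-zero z≈0)) (_ ≤⊤⁺)

  ≤v-+ : ∀ {n z w} → n ≤v z → n ≤v w → n ≤v z + w
  ≤v-+ n≤z n≤w = ≤∞-trans (⊓∞-glb n≤z n≤w) (v-+ _ _)

  ≤v-* : ∀ {m n z w} → m ≤v z → n ≤v w → m ℤ.+ n ≤v z * w
  ≤v-* m≤z n≤w = ≡.subst (_ ≤⁺_) (≡.sym (v-* _ _)) (+∞-mono-≤ m≤z n≤w)

  v-*-≡ : ∀ {m n z w} → v z ≡ [ m ] → v w ≡ [ n ] → v (z * w) ≡ [ m ℤ.+ n ]
  v-*-≡ vz vw = ≡.trans (v-* _ _) (≡.cong₂ _+∞_ vz vw)

  v-1 : v 1# ≡ [ ℤ.0ℤ ]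
  v-1 = ≡.trans (v-cong (sym ι-1)) (v-const K.1# K.1≉0)

  -- Negation is multiplication by the nonzero constant -1, which has valuation 0.
  v-neg : ∀ z → v (- z) ≡ v z
  v-neg z = ≡.trans (v-cong -z≈ι[-1]z) (≡.trans (v-* _ _)
    (≡.trans (≡.cong (_+∞ v z) (v-const (K.- K.1#) -1≉0)) (+∞-identityˡ _)))
    where
    -z≈ι[-1]z : - z ≈ ι (K.- K.1#) * z
    -z≈ι[-1]z = trans (sym (-1*x≈-x z)) (*-congʳ (sym (trans (ι-neg _) (-‿cong ι-1))))
    -1≉0 : K.- K.1# K.≉ K.0#
    -1≉0 -1≈0 = K.1≉0 (K.-‿injective (K.trans -1≈0 (K.sym K.-0#≈0#)))

  ≤v-neg : ∀ {n z} → n ≤v z → n ≤v - z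
  ≤v-neg = ≡.subst (_ ≤⁺_) (≡.sym (v-neg _))

  ≤v-ι : ∀ a → ℤ.0ℤ ≤v ι a
  ≤v-ι a with em {a K.≈ K.0#}
  ... | yes a≈0 = ≤v-zero (trans (ι-cong a≈0) ι-0)
  ... | no  a≉0 = ≤∞-reflexive (≡.sym (v-const a a≉0))

  ≤v-ι* : ∀ {n z} a → n ≤v z → n ≤v ι a * z
  ≤v-ι* {n} a n≤z = ≡.subst (_≤v _) (ℤ.+-identityˡ n) (≤v-* (≤v-ι a) n≤z)

  v-finite : ∀ {z} → z ≉ 0# → ∃[ m ] v z ≡ [ m ]
  v-finite {z} z≉0 with v z in eq
  ... | [ m ] = m , ≡.refl
  ... | ⊤⁺    = contradiction (Equivalence.to (v≡∞⇔x≈0 z) eq) z≉0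

  v-≡⇒≉0 : ∀ {z m} → v z ≡ [ m ] → z ≉ 0#
  v-≡⇒≉0 {z} vz z≈0 with ≡.trans (≡.sym vz) (v-zero z≈0)
  ... | ()

  -- A term of strictly least valuation cannot cancel: otherwise z = -w, and `v z` would be at least
  -- m + 1.
  v-isolated : ∀ {m z w} → v z ≡ [ m ] → ℤ.suc m ≤v w → z + w ≉ 0#
  v-isolated {m} {z} {w} vz m<w z+w≈0 = ℤ.<-irrefl ≡.refl (ℤ.suc[i]≤j⇒i<j ([≤]-injective suc-m≤m))
    where
    suc-m≤m : [ ℤ.suc m ] ≤⁺ [ m ]
    suc-m≤m = ≡.subst (_ ≤⁺_) (≡.trans (v-cong (sym (+-inverseˡ-unique z w z+w≈0))) vz) (≤v-neg m<w)

  v-inverse : ∀ {m z w} → z * w ≈ 1# → v z ≡ [ m ] → v w ≡ [ ℤ.- m ]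
  v-inverse {m} {z} {w} zw≈1 vz with v-finite (inverse-≉0 (trans (*-comm w z) zw≈1))
  ... | n , vw = ≡.trans vw (≡.cong [_] n≡-m)
    where
    m+n≡0 : m ℤ.+ n ≡ ℤ.0ℤ
    m+n≡0 = []-injective (≡.trans (≡.sym (v-*-≡ vz vw)) (≡.trans (v-cong zw≈1) v-1))
    n≡-m : n ≡ ℤ.- m
    n≡-m = ℤ-Group.inverseʳ-unique m n m+n≡0

  -- Nested form of a polynomial with coefficients in `F`: once the constant term is known to
  -- vanish, dividing by `y` leaves an instance of the same form.
  horner : ∀ {n} → (Fin n → Carrier) → Carrier → Carrier
  horner {zero}  c y = 0#
  horner {suc n} c y = c zero + y * horner (c ∘ suc) y

  ∑-powers : ∀ {n} (c : Fin n → Carrier) y → ∑ (λ i → c i * y ^ toℕ i) ≈ horner c y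
  ∑-powers {zero}  c y = refl
  ∑-powers {suc n} c y = +-cong (*-identityʳ _) (begin
    ∑ (λ i → c (suc i) * (y * y ^ toℕ i))  ≈⟨ ∑-cong _ _ (λ i → solve 3 (λ c y p → c :* (y :* p) := y :* (c :* p)) refl (c (suc i)) y (y ^ toℕ i)) ⟩
    ∑ (λ i → y * (c (suc i) * y ^ toℕ i))  ≈⟨ *-distribˡ-sum y (λ i → c (suc i) * y ^ toℕ i) ⟨
    y * ∑ (λ i → c (suc i) * y ^ toℕ i)    ≈⟨ *-congˡ (∑-powers (c ∘ suc) y) ⟩
    y * horner (c ∘ suc) y                 ∎)

  -- Coefficients of valuation 0 cannot cancel in different powers of y.
  horner-independent : ∀ {n} (c : Fin n → Carrier) {y} → y ≉ 0# → ℤ.1ℤ ≤v y →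
    (∀ i → c i ≉ 0# → v (c i) ≡ [ ℤ.0ℤ ]) → horner c y ≈ 0# → ∀ i → c i ≈ 0#
  horner-independent {suc n} c {y} y≉0 1≤y vc horner≈0 = λ { zero → c0≈0 ; (suc i) → c+≈0 i }
    where
    ≤v-horner : ∀ {n} (c : Fin n → Carrier) → (∀ i → c i ≉ 0# → v (c i) ≡ [ ℤ.0ℤ ]) → ℤ.0ℤ ≤v horner c y
    ≤v-horner {zero}  c vc = ≤v-zero refl
    ≤v-horner {suc n} c vc = ≤v-+ head (≤v-* (≤v-weaken (ℤ.+≤+ ℕ.z≤n) 1≤y) (≤v-horner (c ∘ suc) (vc ∘ suc)))
      where
      head : ℤ.0ℤ ≤v c zero
      head with em {c zero ≈ 0#}
      ... | yes c0≈0 = ≤v-zero c0≈0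
      ... | no  c0≉0 = ≤v-≡ ℤ.≤-refl (vc zero c0≉0)

    c0≈0 : c zero ≈ 0#
    c0≈0 = decidable-stable em λ c0≉0 →
      v-isolated (vc zero c0≉0) (≤v-* 1≤y (≤v-horner (c ∘ suc) (vc ∘ suc))) horner≈0

    c+≈0 : ∀ i → c (suc i) ≈ 0#
    c+≈0 = horner-independent (c ∘ suc) y≉0 1≤y (vc ∘ suc) (*-cancelˡ-≈0 y≉0
      (trans (sym (trans (+-congʳ c0≈0) (+-identityˡ _))) horner≈0))

  -- Congruence to a constant modulo the maximal ideal takes the place of the residue field, which
  -- is never built as a quotient.
  HasResidue : Carrier → K.Carrier → Set
  HasResidue z a = ℤ.1ℤ ≤v z - ι a

  residue⇒integral : ∀ {z a} → HasResidue z a → ℤ.0ℤ ≤v z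
  residue⇒integral {z} {a} res = ≤v-resp
    (solve 2 (λ z a → z :- a :+ a := z) refl z (ι a))
    (≤v-+ (≤v-weaken (ℤ.+≤+ ℕ.z≤n) res) (≤v-ι a))

  -- If `z` vanished at the place, so would the nonzero constant a = z - (z - a).
  residue≉0⇒unit : ∀ {z a} → HasResidue z a → a K.≉ K.0# → v z ≡ [ ℤ.0ℤ ]
  residue≉0⇒unit {z} {a} res a≉0 = ≤≱suc⇒≡ (residue⇒integral res) λ 1≤z →
    1≰0 (≡.subst (_ ≤⁺_) (v-const a a≉0)
      (≤v-resp (solve 2 (λ z a → z :- (z :- a) := a) refl z (ι a)) (≤v-+ 1≤z (≤v-neg res))))

  residue-* : ∀ {z w a b} → HasResidue z a → HasResidue w b → HasResidue (z * w) (a K.* b)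
  residue-* {z} {w} {a} {b} resz resw = ≤v-resp
    (trans (solve 4 (λ z w a b → (z :- a) :* w :+ a :* (w :- b) := z :* w :- a :* b) refl z w (ι a) (ι b))
           (+-congˡ (-‿cong (sym (ι-* a b)))))
    (≤v-+ (≤v-* resz (residue⇒integral resw)) (≤v-ι* a resw))

  residue-inverse : ∀ {z w a b} → z * w ≈ 1# → a K.* b K.≈ K.1# → HasResidue z a → HasResidue w b
  residue-inverse {z} {w} {a} {b} zw≈1 ab≈1 res = ≤v-resp (begin
    - (ι b * ((z - ι a) * w))            ≈⟨ solve 4 (λ z w a b → :- (b :* ((z :- a) :* w)) := w :* (a :* b) :- b :* (z :* w))
                                              refl z w (ι a) (ι b) ⟩
    w * (ι a * ι b) - ι b * (z * w)      ≈⟨ +-cong (*-congˡ (ι-inverse ab≈1)) (-‿cong (*-congˡ zw≈1)) ⟩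
    w * 1# - ι b * 1#                    ≈⟨ +-cong (*-identityʳ _) (-‿cong (*-identityʳ _)) ⟩
    w - ι b                              ∎)
    (≤v-neg (≤v-ι* b (≤v-* res 0≤w)))
    where
    a≉0 : a K.≉ K.0#
    a≉0 = K.inverse-≉0 ab≈1
    0≤w : ℤ.0ℤ ≤v w
    0≤w = ≤∞-reflexive (≡.sym (v-inverse zw≈1 (residue≉0⇒unit res a≉0)))

  residue-horner : ∀ {n} (c : Fin n → Carrier) (β : Fin n → K.Carrier) {z} → ℤ.0ℤ ≤v z →
    (∀ i → HasResidue (c i) (β i)) → ℤ.1ℤ ≤v horner c z - eval (tabulate β) z
  residue-horner {zero}  c β 0≤z res = ≤v-zero (-‿inverseʳ 0#)
  residue-horner {suc n} c β {z} 0≤z res = ≤v-resp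
    (solve 5 (λ c b z h e → (c :- b) :+ z :* (h :- e) := (c :+ z :* h) :- (b :+ z :* e)) refl _ _ z _ _)
    (≤v-+ (res zero) (≤v-* 0≤z (residue-horner (c ∘ suc) (β ∘ suc) 0≤z (res ∘ suc))))

-- Every residue field is `K`.

module ResidueField {ℓ} (em : ExcludedMiddle ℓ) (K F : HeytingField ℓ ℓ ℓ)
         (ι : Field.Carrier K → Field.Carrier F) (isHom : IsFieldHom K F ι)
         (closed : IsAlgebraicallyClosed K) (functionField : Polynomial.IsFunctionField K F ι)
         (P : FunctionField.Place em K F ι) where
  open FieldExtension em K F ι isHom
  open Algebra.Properties.Semiring.Exp semiring using (^-homo-*)
  open FunctionField.Place P
  open Valuation em K F ι isHom P
  open import Relation.Binary.Reasoning.Setoid setoid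

  private
    x    = proj₁ functionField
    x-tr = proj₁ (proj₂ functionField)
    span = proj₂ (proj₂ (proj₂ functionField))

  open AlgebraicallyClosed closed {x} x-tr
  open Subfield (k⟨⟩-isSubfield x)
  open IsSubfield (k⟨⟩-isSubfield x)

  -- The n + 1 powers of `z` up to the n-th lie in the span of n elements over K(x).
  algebraic-over-k⟨x⟩ : ∀ z → ∃[ n ] Σ (Fin (suc n) → Carrier) λ c →
    (∀ i → c i ∈k⟨ x ⟩) × (∃[ i ] c i ≉ 0#) × horner c z ≈ 0#
  algebraic-over-k⟨x⟩ z with span-dependent (proj₁ span) (λ i → z ^ toℕ i) (λ i → proj₂ span (z ^ toℕ i))
  ... | c , c∈ , c≉0 , sum≈0 = _ , c , c∈ , c≉0 , trans (sym (∑-powers c z)) sum≈0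

  -- Were the valuation trivial on k⟨x⟩, a uniformiser would be transcendental over it.
  nontrivial : ¬ (∀ r → v (x - ι r) ≡ [ ℤ.0ℤ ])
  nontrivial vx-r with v-onto-1
  ... | t , vt with algebraic-over-k⟨x⟩ t
  ...   | n , c , c∈ , (i , ci≉0) , horner≈0 = ci≉0
    (horner-independent c (v-≡⇒≉0 vt) (≤v-≡ ℤ.≤-refl vt) (λ j → trivial (c∈ j)) horner≈0 i)
    where
    polynomial : ∀ p → eval p x ≉ 0# → v (eval p x) ≡ [ ℤ.0ℤ ]
    polynomial p p≉0 = factorisation (λ z → v z ≡ [ ℤ.0ℤ ]) x
      (λ z≈w → ≡.trans (≡.sym (v-cong z≈w))) v-*-≡ (v-const _) vx-r p (eval-≉0 p≉0)

    trivial : ∀ {z} → z ∈k⟨ x ⟩ → z ≉ 0# → v z ≡ [ ℤ.0ℤ ]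
    trivial {z} (p , r , r≉0 , eq) z≉0 with v-finite z≉0
    ... | m , vz = ≡.trans vz (≡.trans (≡.cong [_] (≡.sym (ℤ.+-identityʳ m)))
      (≡.trans (≡.sym (v-*-≡ vz (polynomial r r≉0))) (≡.trans (v-cong eq) (polynomial p p≉0))))
      where
      p≉0 : eval p x ≉ 0#
      p≉0 p≈0 = *-≉0 z≉0 r≉0 (trans eq p≈0)

  -- The element `u` will be x - a if x has residue a at `P`, and 1/x if x has a pole there. It
  -- generates the maximal ideal below `P` in K(x) but need not be a uniformiser of `P`, because `P`
  -- may be ramified; hence only a lower bound on its valuation.
  module UnitTimesPower (u : Carrier) (1≤u : ℤ.1ℤ ≤v u) where

    -- c = uʲ⁻ⁱ w, where w is a unit whose residue lies in K.
    Monomial : Pred Carrier ℓ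
    Monomial c = ∃[ i ] ∃[ j ] ∃[ w ] ∃[ a ] c * u ^ i ≈ u ^ j * w × a K.≉ K.0# × HasResidue w a

    monomial-resp : ∀ {c d} → c ≈ d → Monomial c → Monomial d
    monomial-resp c≈d (i , j , w , a , eq , rest) = i , j , w , a , trans (*-congʳ (sym c≈d)) eq , rest

    monomial-* : ∀ {c d} → Monomial c → Monomial d → Monomial (c * d)
    monomial-* {c} {d} (i , j , w , a , eq , a≉0 , res) (i′ , j′ , w′ , a′ , eq′ , a′≉0 , res′) =
      i ℕ.+ i′ , j ℕ.+ j′ , w * w′ , a K.* a′ , (begin
        c * d * u ^ (i ℕ.+ i′)            ≈⟨ *-congˡ (^-homo-* u i i′) ⟩
        c * d * (u ^ i * u ^ i′)          ≈⟨ solve 4 (λ c d p q → c :* d :* (p :* q) := c :* p :* (d :* q)) refl c d (u ^ i) (u ^ i′) ⟩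
        c * u ^ i * (d * u ^ i′)          ≈⟨ *-cong eq eq′ ⟩
        u ^ j * w * (u ^ j′ * w′)         ≈⟨ solve 4 (λ p w q w′ → p :* w :* (q :* w′) := p :* q :* (w :* w′)) refl (u ^ j) w (u ^ j′) w′ ⟩
        u ^ j * u ^ j′ * (w * w′)         ≈⟨ *-congʳ (^-homo-* u j j′) ⟨
        u ^ (j ℕ.+ j′) * (w * w′)         ∎) , K.*-≉0 a≉0 a′≉0 , residue-* res res′

    monomial-inverse : ∀ {c d} → c * d ≈ 1# → Monomial c → Monomial d
    monomial-inverse {c} {d} cd≈1 (i , j , w , a , eq , a≉0 , res)
        with K.≉0⇒invertible a≉0 | ≉0⇒invertible (v-≡⇒≉0 (residue≉0⇒unit res a≉0))
    ... | b , ab≈1 | w⁻¹ , ww⁻¹≈1 = j , i , w⁻¹ , b , (begin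
        d * u ^ j                     ≈⟨ *-identityʳ _ ⟨
        d * u ^ j * 1#                ≈⟨ *-congˡ ww⁻¹≈1 ⟨
        d * u ^ j * (w * w⁻¹)         ≈⟨ solve 4 (λ d p w s → d :* p :* (w :* s) := d :* (p :* w) :* s) refl d (u ^ j) w w⁻¹ ⟩
        d * (u ^ j * w) * w⁻¹         ≈⟨ *-congʳ (*-congˡ eq) ⟨
        d * (c * u ^ i) * w⁻¹         ≈⟨ solve 4 (λ d c p s → d :* (c :* p) :* s := c :* d :* (p :* s)) refl d c (u ^ i) w⁻¹ ⟩
        c * d * (u ^ i * w⁻¹)         ≈⟨ *-congʳ cd≈1 ⟩
        1# * (u ^ i * w⁻¹)            ≈⟨ *-identityˡ _ ⟩
        u ^ i * w⁻¹                   ∎)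
      , K.inverse-≉0 (K.trans (K.*-comm b a) ab≈1) , residue-inverse ww⁻¹≈1 ab≈1 res

    u≉0⇒u^≉0 : u ≉ 0# → ∀ n → u ^ n ≉ 0#
    u≉0⇒u^≉0 u≉0 zero    = 1≉0
    u≉0⇒u^≉0 u≉0 (suc n) = *-≉0 u≉0 (u≉0⇒u^≉0 u≉0 n)

    0≤u^ : ∀ n → ℤ.0ℤ ≤v u ^ n
    0≤u^ zero    = ≤v-≡ ℤ.≤-refl v-1
    0≤u^ (suc n) = ≤v-* (≤v-weaken (ℤ.+≤+ ℕ.z≤n) 1≤u) (0≤u^ n)

    ^-cancel : u ≉ 0# → ∀ m {y z} → u ^ m * y ≈ u ^ m * z → y ≈ z
    ^-cancel u≉0 m {y} {z} eq = trans (sym (+-identityʳ y))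
      (trans (+-congˡ (sym (-‿inverseˡ z))) (trans (sym (+-assoc y (- z) z)) (trans (+-congʳ y-z≈0) (+-identityˡ z))))
      where
      y-z≈0 : y - z ≈ 0#
      y-z≈0 = *-cancelˡ-≈0 (u≉0⇒u^≉0 u≉0 m) (trans (x[y-z]≈xy-xz _ y z) (trans (+-congʳ eq) (-‿inverseʳ _)))

    -- Cancelling powers of `u` leaves three cases. If j < i, the unit `w` would be `u` times an
    -- integral element, hence no unit. If j = i, then c = w has residue `a`. If j > i, then `c` is
    -- divisible by `u` and has residue 0.
    monomial⇒residue : u ≉ 0# → ∀ {c} → ℤ.0ℤ ≤v c → Monomial c → ∃[ a ] HasResidue c a
    monomial⇒residue u≉0 {c} 0≤c (i , j , w , a , eq , a≉0 , res) with ℕ.<-≤-connex j i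
    ... | inj₁ j<i = contradiction (≡.subst (_ ≤⁺_) (residue≉0⇒unit res a≉0) (≤v-resp cu≈w 1≤cu)) 1≰0
      where
      k = i ℕ.∸ suc j
      cu≈w : u * (c * u ^ k) ≈ w
      cu≈w = ^-cancel u≉0 j (begin
        u ^ j * (u * (c * u ^ k))    ≈⟨ solve 4 (λ p u c q → p :* (u :* (c :* q)) := c :* (u :* p :* q)) refl (u ^ j) u c (u ^ k) ⟩
        c * (u ^ suc j * u ^ k)      ≈⟨ *-congˡ (^-homo-* u (suc j) k) ⟨
        c * u ^ (suc j ℕ.+ k)        ≡⟨ ≡.cong (λ m → c * u ^ m) (ℕ.m+[n∸m]≡n j<i) ⟩
        c * u ^ i                    ≈⟨ eq ⟩
        u ^ j * w                    ∎)
      1≤cu : ℤ.1ℤ ≤v u * (c * u ^ k)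
      1≤cu = ≤v-* 1≤u (≤v-* 0≤c (0≤u^ k))
    ... | inj₂ i≤j = split (j ℕ.∸ i) (^-cancel u≉0 i (begin
        u ^ i * c                       ≈⟨ *-comm _ _ ⟩
        c * u ^ i                       ≈⟨ eq ⟩
        u ^ j * w                       ≡⟨ ≡.cong (λ m → u ^ m * w) (ℕ.m+[n∸m]≡n i≤j) ⟨
        u ^ (i ℕ.+ (j ℕ.∸ i)) * w       ≈⟨ *-congʳ (^-homo-* u i (j ℕ.∸ i)) ⟩
        u ^ i * u ^ (j ℕ.∸ i) * w       ≈⟨ *-assoc _ _ _ ⟩
        u ^ i * (u ^ (j ℕ.∸ i) * w)     ∎))
      where
      split : ∀ k → c ≈ u ^ k * w → ∃[ a ] HasResidue c a
      split zero    c≈w  = a , ≤v-resp (+-congʳ (sym (trans c≈w (*-identityˡ w)))) res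
      split (suc k) c≈uw = K.0# , ≤v-resp (trans (trans (sym (*-assoc _ _ _)) (sym c≈uw)) (sym (trans (+-congˡ (-‿cong ι-0)) (x-0≈x c))))
        (≤v-* 1≤u (≤v-* (0≤u^ k) (residue⇒integral res)))

    -- Numerator and denominator split into linear factors, so both, and then their quotient, are
    -- monomials as soon as all x - r are.
    residue-k⟨x⟩ : u ≉ 0# → (∀ r → Monomial (x - ι r)) → ∀ {c} → c ∈k⟨ x ⟩ → ℤ.0ℤ ≤v c → ∃[ a ] HasResidue c a
    residue-k⟨x⟩ u≉0 linear {c} (p , r , r≉0 , eq) 0≤c with em {c ≈ 0#}
    ... | yes c≈0 = K.0# , ≤v-zero (trans (+-cong c≈0 (-‿cong ι-0)) (-‿inverseʳ 0#))
    ... | no  c≉0 with ≉0⇒invertible r≉0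
    ...   | r⁻¹ , rr⁻¹≈1 = monomial⇒residue u≉0 0≤c (monomial-resp (begin
        eval p x * r⁻¹           ≈⟨ *-congʳ eq ⟨
        c * eval r x * r⁻¹       ≈⟨ *-assoc _ _ _ ⟩
        c * (eval r x * r⁻¹)     ≈⟨ *-congˡ rr⁻¹≈1 ⟩
        c * 1#                   ≈⟨ *-identityʳ c ⟩
        c                        ∎) (monomial-* (polynomial p p≉0) (monomial-inverse rr⁻¹≈1 (polynomial r r≉0))))
      where
      p≉0 : eval p x ≉ 0#
      p≉0 p≈0 = *-≉0 c≉0 r≉0 (trans eq p≈0)

      residue-ι : ∀ a → HasResidue (ι a) a
      residue-ι a = ≤v-zero (-‿inverseʳ (ι a))

      polynomial : ∀ p → eval p x ≉ 0# → Monomial (eval p x)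
      polynomial p p≉0 = factorisation Monomial x monomial-resp monomial-*
        (λ {a} a≉0 → 0 , 0 , ι a , a , *-comm _ _ , a≉0 , residue-ι a) linear p (eval-≉0 p≉0)

  private
    _≤v?_ : ∀ n z → Dec (n ≤v z)
    n ≤v? z = ≤⁺-dec ℤ._≤?_ [ n ] (v z)

    ^1 : ∀ u → u ^ 1 ≈ u
    ^1 = *-identityʳ

  -- Either x has a residue in `K`, or x has a pole, or x is integral without a residue in `K`. In
  -- the last case every x - r would be a unit, which `nontrivial` excludes.
  residue-of-k⟨x⟩ : ∀ {c} → c ∈k⟨ x ⟩ → ℤ.0ℤ ≤v c → ∃[ a ] HasResidue c a
  residue-of-k⟨x⟩ with em {∃[ a ] ℤ.1ℤ ≤v x - ι a}
  ... | yes (a , 1≤u) = residue-k⟨x⟩ (λ u≈0 → x-tr (algebraic u≈0)) linear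
    where
    u = x - ι a
    open UnitTimesPower u 1≤u

    algebraic : u ≈ 0# → Algebraic x
    algebraic u≈0 = K.- a ∷ K.1# ∷ [] , there (here K.1≉0) , (begin
      ι (K.- a) + x * (ι K.1# + x * 0#)  ≈⟨ +-cong (ι-neg a) (*-congˡ (trans (+-congˡ (zeroʳ x)) (trans (+-identityʳ _) ι-1))) ⟩
      - ι a + x * 1#                     ≈⟨ +-congˡ (*-identityʳ x) ⟩
      - ι a + x                          ≈⟨ +-comm _ _ ⟩
      u                                  ≈⟨ u≈0 ⟩
      0#                                 ∎)

    linear : ∀ r → Monomial (x - ι r)
    linear r with em {a K.≈ r}
    ... | yes a≈r = 0 , 1 , 1# , K.1# , (begin
      (x - ι r) * 1#     ≈⟨ *-congʳ (+-congˡ (-‿cong (ι-cong a≈r))) ⟨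
      u * 1#             ≈⟨ *-congʳ (^1 u) ⟨
      u ^ 1 * 1#         ∎) , K.1≉0 , ≤v-zero (trans (+-congˡ (-‿cong ι-1)) (-‿inverseʳ 1#))
    -- Here x - r is itself a unit, congruent to the nonzero constant a - r.
    ... | no  a≉r = 0 , 0 , x - ι r , a K.- r , *-comm _ _ , (λ a-r≈0 → a≉r (K.x∙y⁻¹≈ε⇒x≈y a r a-r≈0)) ,
      ≤v-resp (begin
        x - ι a                          ≈⟨ solve 3 (λ x a r → x :- a := (x :- r) :- (a :- r)) refl x (ι a) (ι r) ⟩
        (x - ι r) - (ι a - ι r)          ≈⟨ +-congˡ (-‿cong (trans (ι-+ _ _) (+-congˡ (ι-neg r)))) ⟨
        (x - ι r) - ι (a K.- r)          ∎) 1≤u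
  ... | no nonresidue with ℤ.0ℤ ≤v? x
  ...   | yes 0≤x = contradiction (λ r → ≤≱suc⇒≡ (≤v-+ 0≤x (≤v-neg (≤v-ι r))) (λ 1≤ → nonresidue (r , 1≤))) nontrivial
  ...   | no  0≰x with ≉0⇒invertible (λ x≈0 → 0≰x (≤v-zero x≈0))
  ...     | u , xu≈1 = residue-k⟨x⟩ u≉0 linear
    where
    u≉0 : u ≉ 0#
    u≉0 = inverse-≉0 (trans (*-comm u x) xu≈1)

    1≤u : ℤ.1ℤ ≤v u
    1≤u with v-finite (inverse-≉0 xu≈1)
    ... | m , vx = ≤v-≡ (≰0⇒≤-1 (λ 0≤m → 0≰x (≡.subst (_ ≤⁺_) (≡.sym vx) 0≤m))) (v-inverse xu≈1 vx)

    open UnitTimesPower u 1≤u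

    linear : ∀ r → Monomial (x - ι r)
    -- With u = 1/x one has (x - r)u = 1 - ru, a unit with residue 1.
    linear r = 1 , 0 , 1# - ι r * u , K.1# , (begin
      (x - ι r) * u ^ 1        ≈⟨ *-congˡ (^1 u) ⟩
      (x - ι r) * u            ≈⟨ [y-z]x≈yx-zx u x (ι r) ⟩
      x * u - ι r * u          ≈⟨ +-congʳ xu≈1 ⟩
      1# - ι r * u             ≈⟨ *-identityˡ _ ⟨
      1# * (1# - ι r * u)      ∎) , K.1≉0 , ≤v-resp (begin
      - (ι r * u)              ≈⟨ solve 2 (λ o y → :- y := (o :- y) :- o) refl 1# (ι r * u) ⟩
      (1# - ι r * u) - 1#      ≈⟨ +-congˡ (-‿cong ι-1) ⟨
      (1# - ι r * u) - ι K.1#  ∎) (≤v-neg (≤v-ι* r 1≤u))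

  -- An integral z satisfies an equation over k⟨x⟩; divided by a coefficient of
  -- least valuation, it reduces to a polynomial over K with root z modulo P.
  residue-exists : ∀ {z} → ℤ.0ℤ ≤v z → ∃[ a ] HasResidue z a
  residue-exists {z} 0≤z with em {∃[ a ] HasResidue z a}
  ... | yes res = res
  ... | no nonresidue with algebraic-over-k⟨x⟩ z
  ...   | n , c , c∈ , (i₀ , ci₀≉0) , horner≈0 with minimum (v ∘ c)
  ...     | k , min with v-finite ck≉0
    where
    ck≉0 : c k ≉ 0#
    ck≉0 ck≈0 with v-finite ci₀≉0
    ... | m , vci₀ = absurd (≡.subst₂ _≤⁺_ (v-zero ck≈0) vci₀ (min i₀))
      where
      absurd : ¬ (⊤⁺ ≤⁺ [ m ])
      absurd ()
  ...       | m , vck with ≉0⇒invertible (v-≡⇒≉0 vck)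
  ...         | s , cks≈1 = contradiction (≡.subst (_ ≤⁺_) unit reduction) 1≰0
    where
    d : Fin (suc n) → Carrier
    d i = c i * s

    s∈ : s ∈k⟨ x ⟩
    s∈ = ⁻¹closed (c∈ k) cks≈1

    0≤d : ∀ i → ℤ.0ℤ ≤v d i
    0≤d i = ≡.subst (_≤v d i) (ℤ.+-inverseʳ m)
      (≤v-* (≡.subst (_≤⁺ v (c i)) vck (min i)) (≤v-≡ ℤ.≤-refl (v-inverse cks≈1 vck)))

    β : Fin (suc n) → K.Carrier
    β i = proj₁ (residue-of-k⟨x⟩ (*-closed (c∈ i) s∈) (0≤d i))

    res : ∀ i → HasResidue (d i) (β i)
    res i = proj₂ (residue-of-k⟨x⟩ (*-closed (c∈ i) s∈) (0≤d i))

    βk≉0 : β k K.≉ K.0#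
    βk≉0 βk≈0 = 1≰0 (≡.subst (_ ≤⁺_) v-1 (≤v-resp (begin
      d k - ι (β k)   ≈⟨ +-cong cks≈1 (-‿cong (trans (ι-cong βk≈0) ι-0)) ⟩
      1# - 0#         ≈⟨ x-0≈x 1# ⟩
      1#              ∎) (res k)))

    horner-scale : ∀ {n} (c : Fin n → Carrier) → horner (λ i → c i * s) z ≈ horner c z * s
    horner-scale {zero}  c = sym (zeroˡ s)
    horner-scale {suc n} c = trans (+-congˡ (*-congˡ (horner-scale (c ∘ suc))))
      (solve 4 (λ c s z h → c :* s :+ z :* (h :* s) := (c :+ z :* h) :* s) refl (c zero) s z (horner (c ∘ suc) z))

    reduction : ℤ.1ℤ ≤v eval (tabulate β) z
    reduction = ≤v-resp (begin
      - (horner d z - e)  ≈⟨ -‿cong (+-congʳ (trans (horner-scale c) (trans (*-congʳ horner≈0) (zeroˡ s)))) ⟩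
      - (0# - e)          ≈⟨ solve 1 (λ e → :- (con (+ 0) :- e) := e) refl e ⟩
      e                   ∎) (≤v-neg (residue-horner d β 0≤z res))
      where
      e = eval (tabulate β) z

    -- Without a residue in `K` every z - r is a unit, and then so is the value at `z` of any
    -- nonzero polynomial, contrary to `reduction`.
    unit : v (eval (tabulate β) z) ≡ [ ℤ.0ℤ ]
    unit = factorisation (λ z → v z ≡ [ ℤ.0ℤ ]) z
      (λ z≈w → ≡.trans (≡.sym (v-cong z≈w))) v-*-≡ (v-const _)
      (λ r → ≤≱suc⇒≡ (≤v-+ 0≤z (≤v-neg (≤v-ι r))) (λ 1≤ → nonresidue (r , 1≤)))
      (tabulate β) (Any.tabulate⁺ {f = β} k βk≉0)

  -- The quotient z/w is integral; its residue is the required `a`. Hence one more allowed pole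
  -- costs at most one dimension.
  residue-of-quotient : ∀ {m z w} → v w ≡ [ m ] → m ≤v z → ∃[ a ] ℤ.suc m ≤v z - ι a * w
  residue-of-quotient {m} {z} {w} vw m≤z with ≉0⇒invertible (v-≡⇒≉0 vw)
  ... | s , ws≈1 with residue-exists (≡.subst (_≤v z * s) (ℤ.+-inverseʳ m) (≤v-* m≤z (≤v-≡ ℤ.≤-refl (v-inverse ws≈1 vw))))
  ...   | a , res = a , ≤v-resp (begin
    (z * s - ι a) * w      ≈⟨ solve 4 (λ z s a w → (z :* s :- a) :* w := z :* (w :* s) :- a :* w) refl z s (ι a) w ⟩
    z * (w * s) - ι a * w  ≈⟨ +-congʳ (trans (*-congˡ ws≈1) (*-identityʳ z)) ⟩
    z - ι a * w            ∎) (≤v-* res (≤v-≡ ℤ.≤-refl vw))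

-- Gaps of a numerical semigroup.

module Counting {ℓ} (em : ExcludedMiddle ℓ) where

  indicator : Set ℓ → ℕ
  indicator A with em {A}
  ... | yes _ = 1
  ... | no  _ = 0

  count : (ℕ → Set ℓ) → ℕ → ℕ
  count P zero    = 0
  count P (suc n) = indicator (P n) ℕ.+ count P n

  indicator-mono : ∀ {A B} → (A → B) → indicator A ℕ.≤ indicator B
  indicator-mono {A} {B} A→B with em {A} | em {B}
  ... | yes a | yes b = ℕ.≤-refl
  ... | yes a | no ¬b = contradiction (A→B a) ¬b
  ... | no ¬a | _     = ℕ.z≤n

  indicator-complement : ∀ A → indicator A ℕ.+ indicator (¬ A) ≡ 1
  indicator-complement A with em {A} | em {¬ A}
  ... | yes a | yes ¬a = contradiction a ¬a
  ... | yes a | no  _  = ≡.refl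
  ... | no ¬a | yes _  = ≡.refl
  ... | no ¬a | no ¬¬a = contradiction ¬a ¬¬a

  open import Data.Nat.Solver using (module +-*-Solver)
  open +-*-Solver

  count-complement : ∀ P n → count P n ℕ.+ count (λ i → ¬ P i) n ≡ n
  count-complement P zero    = ≡.refl
  count-complement P (suc n) = ≡.trans
    (solve 4 (λ a b c d → (a :+ b) :+ (c :+ d) := (a :+ c) :+ (b :+ d)) ≡.refl
      (indicator (P n)) (count P n) (indicator (¬ P n)) (count (λ i → ¬ P i) n))
    (≡.cong₂ ℕ._+_ (indicator-complement (P n)) (count-complement P n))

  count-front : ∀ P n → count P (suc n) ≡ indicator (P 0) ℕ.+ count (P ∘ suc) n
  count-front P zero    = ≡.refl
  count-front P (suc n) = ≡.trans (≡.cong (indicator (P (suc n)) ℕ.+_) (count-front P n))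
    (solve 3 (λ a b c → a :+ (b :+ c) := b :+ (a :+ c)) ≡.refl (indicator (P (suc n))) (indicator (P 0)) (count (P ∘ suc) n))

  -- The reversal of {0, ..., n - 1}, expressed by `suc (i ℕ.+ j) ≡ n` to avoid truncated
  -- subtraction. The induction removes the top of `P` and the bottom of `Q`.
  count-reflect : ∀ n P Q → (∀ i j → suc (i ℕ.+ j) ≡ n → P i → Q j) → count P n ℕ.≤ count Q n
  count-reflect zero    P Q P→Q = ℕ.z≤n
  count-reflect (suc n) P Q P→Q = ≡.subst (count P (suc n) ℕ.≤_) (≡.sym (count-front Q n))
    (ℕ.+-mono-≤ (indicator-mono (P→Q n 0 (≡.cong suc (ℕ.+-identityʳ n))))
      (count-reflect n P (Q ∘ suc) λ i j eq → P→Q i (suc j) (≡.cong suc (≡.trans (ℕ.+-suc i j) eq))))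

  -- If M is not in the semigroup P, then i ↦ M ∸ i maps P ∩ [0, M] into the
  -- complement, which has at most g elements.
  semigroup-gaps : ∀ (P : ℕ → Set ℓ) g → (∀ {a b} → P a → P b → P (a ℕ.+ b)) →
    (∀ n → n ℕ.≤ g ℕ.+ count P n) → ∀ n → 2 ℕ.* g ℕ.≤ n → P n
  semigroup-gaps P g add bound n 2g≤n = decidable-stable em λ ¬Pn →
    let gaps  = count (λ i → ¬ P i) (suc n)
        gaps≤g : gaps ℕ.≤ g
        gaps≤g = ℕ.+-cancelˡ-≤ (count P (suc n)) gaps g (ℕ.≤-trans (ℕ.≤-reflexive (count-complement P (suc n)))
          (≡.subst (suc n ℕ.≤_) (ℕ.+-comm g _) (bound (suc n))))
        P≤gaps : count P (suc n) ℕ.≤ gaps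
        P≤gaps = count-reflect (suc n) P (λ i → ¬ P i) λ i j eq Pi Pj →
          ¬Pn (≡.subst P (ℕ.suc-injective eq) (add Pi Pj))
    -- The n + 1 numbers up to n consist of at most g members of `P` and at most g gaps, yet 2g ≤ n.
    in ℕ.1+n≰n (ℕ.≤-trans (ℕ.≤-trans (ℕ.≤-reflexive (≡.sym (count-complement P (suc n))))
         (ℕ.≤-trans (ℕ.+-mono-≤ (ℕ.≤-trans P≤gaps gaps≤g) gaps≤g)
           (ℕ.≤-reflexive (≡.cong (g ℕ.+_) (≡.sym (ℕ.+-identityʳ g)))))) 2g≤n)

-- Dimensions of `K`-subspaces of `F`.

module Dimension {ℓ} (em : ExcludedMiddle ℓ) (K F : HeytingField ℓ ℓ ℓ)
         (ι : Field.Carrier K → Field.Carrier F) (isHom : IsFieldHom K F ι) where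
  open FieldExtension em K F ι isHom
  open FunctionField em K F ι
  open import Relation.Binary.Reasoning.Setoid setoid

  comb : ∀ {n} → (Fin n → K.Carrier) → (Fin n → Carrier) → Carrier
  comb a b = ∑ λ i → ι (a i) * b i

  comb-* : ∀ {n} h a (b : Fin n → Carrier) → comb a (λ i → h * b i) ≈ h * comb a b
  comb-* h a b = trans (∑-cong (λ i → ι (a i) * (h * b i)) (λ i → h * (ι (a i) * b i))
      (λ i → solve 3 (λ a h b → a :* (h :* b) := h :* (a :* b)) refl (ι (a i)) h (b i)))
    (sym (*-distribˡ-sum h (λ i → ι (a i) * b i)))

  Dim : Pred Carrier ℓ → ℕ → Set ℓ
  Dim U = HasDim U (_≈ 0#)

  record IsSubspace (U : Pred Carrier ℓ) : Set ℓ where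
    field
      resp     : ∀ {z w} → z ≈ w → z ∈ U → w ∈ U
      0∈       : 0# ∈ U
      +-closed : ∀ {z w} → z ∈ U → w ∈ U → z + w ∈ U
      ι-closed : ∀ {z} a → z ∈ U → ι a * z ∈ U

    comb-closed : ∀ {n} a (b : Fin n → Carrier) → (∀ i → b i ∈ U) → comb a b ∈ U
    comb-closed {zero}  a b b∈ = 0∈
    comb-closed {suc n} a b b∈ = +-closed (ι-closed (a zero) (b∈ zero)) (comb-closed (a ∘ suc) (b ∘ suc) (b∈ ∘ suc))

    solve-for : ∀ {a w y} → a K.≉ K.0# → y ∈ U → ι a * w + y ≈ 0# → w ∈ U
    solve-for {a} {w} {y} a≉0 y∈ eq with K.≉0⇒invertible a≉0
    ... | b , ab≈1 = resp (begin
      ι (K.- b) * y        ≈⟨ *-congʳ (ι-neg b) ⟩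
      - ι b * y            ≈⟨ *-congˡ (+-inverseʳ-unique (ι a * w) y eq) ⟩
      - ι b * - (ι a * w)  ≈⟨ solve 3 (λ b a w → :- b :* (:- (a :* w)) := a :* b :* w) refl (ι b) (ι a) w ⟩
      ι a * ι b * w        ≈⟨ *-congʳ (ι-inverse ab≈1) ⟩
      1# * w               ≈⟨ *-identityˡ w ⟩
      w                    ∎) (ι-closed (K.- b) y∈)

  dim-extend : ∀ {U W n w} → IsSubspace W → W ⊆ U → Dim W n → w ∈ U → ¬ (w ∈ W) →
    (∀ {z} → z ∈ U → ∃[ a ] z - ι a * w ∈ W) → Dim U (suc n)
  dim-extend {U} {W} {n} {w} isSubspace W⊆U (b , b∈ , indep , span) w∈U w∉W reduce = b′ , b′∈ , indep′ , span′
    where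
    open IsSubspace isSubspace

    b′ : Fin (suc n) → Carrier
    b′ zero    = w
    b′ (suc i) = b i

    b′∈ : ∀ i → b′ i ∈ U
    b′∈ zero    = w∈U
    b′∈ (suc i) = W⊆U (b∈ i)

    indep′ : ∀ a → comb a b′ ≈ 0# → ∀ i → a i K.≈ K.0#
    indep′ a eq = λ { zero → a₀≈0 ; (suc i) → indep (a ∘ suc) rest≈0 i }
      where
      a₀≈0 : a zero K.≈ K.0#
      a₀≈0 = decidable-stable em λ a₀≉0 → w∉W (solve-for a₀≉0 (comb-closed (a ∘ suc) b b∈) eq)
      rest≈0 : comb (a ∘ suc) b ≈ 0#
      rest≈0 = trans (sym (trans (+-congʳ (trans (*-congʳ (trans (ι-cong a₀≈0) ι-0)) (zeroˡ w))) (+-identityˡ _))) eq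

    span′ : ∀ z → z ∈ U → ∃[ a ] z - comb a b′ ≈ 0#
    span′ z z∈U with reduce z∈U
    ... | a₀ , z-a₀w∈W with span _ z-a₀w∈W
    ...   | a , eq = a′ , trans (solve 3 (λ z x y → z :- (x :+ y) := z :- x :- y) refl z (ι a₀ * w) (comb a b)) eq
      where
      a′ : Fin (suc n) → K.Carrier
      a′ zero    = a₀
      a′ (suc i) = a i

  -- Coordinates over `K` are moved to its image in `F`, where elimination over a subfield applies,
  -- and the relation found is pulled back.
  dim-dependent : ∀ {U n} → Dim U n → (e : Fin (suc n) → Carrier) → (∀ i → e i ∈ U) →
    ∃[ a ] (∃[ i ] a i K.≉ K.0#) × comb a e ≈ 0#
  dim-dependent {U} {n} (b , _ , _ , span) e e∈
      with Subfield.span-dependent ιK-isSubfield b e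
        (λ j → ι ∘ proj₁ (span (e j) (e∈ j)) , (λ i → _ , refl) , x∙y⁻¹≈ε⇒x≈y (e j) _ (proj₂ (span (e j) (e∈ j))))
  ... | c , c∈ , (i , ci≉0) , eq = a , (i , λ ai≈0 → ci≉0 (trans (sym (proj₂ (c∈ i))) (trans (ι-cong ai≈0) ι-0))) ,
    trans (∑-cong (λ i → ι (a i) * e i) (λ i → c i * e i) λ i → *-congʳ (proj₂ (c∈ i))) eq
    where
    a : Fin (suc n) → K.Carrier
    a i = proj₁ (c∈ i)

  -- An element `z` of `U` and a basis of `W` are n + 1 elements of `U`, hence dependent. The basis
  -- being independent, the coefficient of `z` is nonzero and the relation can be solved for `z`.
  dim-≡⇒⊆ : ∀ {U W n} → IsSubspace W → W ⊆ U → Dim U n → Dim W n → U ⊆ W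
  dim-≡⇒⊆ {U} {W} {n} isSubspace W⊆U dimU (b , b∈ , indep , _) {z} z∈U with dim-dependent dimU e e∈
    where
    e : Fin (suc n) → Carrier
    e zero    = z
    e (suc i) = b i
    e∈ : ∀ i → e i ∈ U
    e∈ zero    = z∈U
    e∈ (suc i) = W⊆U (b∈ i)
  ... | a , (i , ai≉0) , eq = solve-for a₀≉0 (comb-closed (a ∘ suc) b b∈) eq
    where
    open IsSubspace isSubspace
    a₀≉0 : a zero K.≉ K.0#
    a₀≉0 a₀≈0 = ai≉0 (zeros i)
      where
      rest≈0 : comb (a ∘ suc) b ≈ 0#
      rest≈0 = trans (sym (trans (+-congʳ (trans (*-congʳ (trans (ι-cong a₀≈0) ι-0)) (zeroˡ z))) (+-identityˡ _))) eq
      zeros : ∀ i → a i K.≈ K.0#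
      zeros zero    = a₀≈0
      zeros (suc i) = indep (a ∘ suc) rest≈0 i

  dim-resp : ∀ {U W n} → U ⊆ W → W ⊆ U → Dim U n → Dim W n
  dim-resp U⊆W W⊆U (b , b∈ , indep , span) = b , (λ i → U⊆W (b∈ i)) , indep , λ z z∈W → span z (W⊆U z∈W)

  dim-scale : ∀ {U W n h h⁻¹} → h * h⁻¹ ≈ 1# → (∀ {z w} → z ≈ w → z ∈ U → w ∈ U) →
    (∀ {z} → z ∈ U → h * z ∈ W) → (∀ {z} → z ∈ W → h⁻¹ * z ∈ U) → Dim U n → Dim W n
  dim-scale {U} {W} {n} {h} {h⁻¹} hh⁻¹≈1 resp to from (b , b∈ , indep , span) =
    (λ i → h * b i) , (λ i → to (b∈ i)) ,
    (λ a eq → indep a (*-cancelˡ-≈0 (inverse-≉0 hh⁻¹≈1) (trans (sym (comb-* h a b)) eq))) ,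
    λ z z∈W → let a , eq = span (h⁻¹ * z) (from z∈W) in a , (begin
      z - comb a (λ i → h * b i)      ≈⟨ +-cong (sym (trans (*-congʳ hh⁻¹≈1) (*-identityˡ z))) (-‿cong (comb-* h a b)) ⟩
      h * h⁻¹ * z - h * comb a b      ≈⟨ solve 4 (λ h s z c → h :* s :* z :- h :* c := h :* (s :* z :- c)) refl h h⁻¹ z (comb a b) ⟩
      h * (h⁻¹ * z - comb a b)        ≈⟨ *-congˡ eq ⟩
      h * 0#                          ≈⟨ zeroʳ h ⟩
      0#                              ∎)

private module _ where
  open Data.Integer.Solver.+-*-Solver

  suc-neg : ∀ c → ℤ.suc (ℤ.- (ℤ.1ℤ ℤ.+ c)) ≡ ℤ.- c
  suc-neg = solve 1 (λ c → con ℤ.1ℤ :+ (:- (con ℤ.1ℤ :+ c)) := :- c) ≡.refl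

  degree-suc : ∀ d n → ℤ.1ℤ ℤ.* ℤ.1ℤ ℤ.+ d ℤ.- n ℤ.+ ℤ.1ℤ ≡ ℤ.suc (d ℤ.- n ℤ.+ ℤ.1ℤ)
  degree-suc = solve 2 (λ d n → con ℤ.1ℤ :* con ℤ.1ℤ :+ d :- n :+ con ℤ.1ℤ := con ℤ.1ℤ :+ (d :- n :+ con ℤ.1ℤ)) ≡.refl

  deg-dim : ∀ k n → k ℤ.- ℤ.1ℤ ℤ.- n ℤ.+ ℤ.1ℤ ℤ.+ n ≡ k
  deg-dim = solve 2 (λ k n → k :- con ℤ.1ℤ :- n :+ con ℤ.1ℤ :+ n := k) ≡.refl

-- Riemann-Roch spaces and pole orders at one place.

module RiemannRochSpaces {ℓ} (em : ExcludedMiddle ℓ) (K F : HeytingField ℓ ℓ ℓ)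
         (ι : Field.Carrier K → Field.Carrier F) (isHom : IsFieldHom K F ι)
         (closed : IsAlgebraicallyClosed K) (functionField : Polynomial.IsFunctionField K F ι) where
  open FieldExtension em K F ι isHom
  open FunctionField em K F ι
  open Dimension em K F ι isHom
  private
    module V = Valuation em K F ι isHom
    module R = ResidueField em K F ι isHom closed functionField
  open import Relation.Binary.Reasoning.Setoid setoid

  -- The contribution of one listed term to `coeff`, named so that it is unfolded only in the next
  -- few lemmas.
  δ : Place → Place → ℤ → ℤ
  δ Q P n = if does (em {Q ≈ᵖ P}) then n else ℤ.0ℤ

  δ-≈ : ∀ Q P n → Q ≈ᵖ P → δ Q P n ≡ n
  δ-≈ Q P n Q≈P with em {Q ≈ᵖ P}
  ... | yes _   = ≡.refl
  ... | no  Q≉P = contradiction (λ z → Q≈P z) Q≉P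

  δ-≉ : ∀ Q P n → ¬ (Q ≈ᵖ P) → δ Q P n ≡ ℤ.0ℤ
  δ-≉ Q P n Q≉P with em {Q ≈ᵖ P}
  ... | yes Q≈P = contradiction (λ z → Q≈P z) Q≉P
  ... | no  _   = ≡.refl

  δ-+ : ∀ Q P m n → δ Q P (m ℤ.+ n) ≡ δ Q P m ℤ.+ δ Q P n
  δ-+ Q P m n with em {Q ≈ᵖ P}
  ... | yes _ = ≡.refl
  ... | no  _ = ≡.refl

  δ-neg : ∀ Q P n → δ Q P (ℤ.- n) ≡ ℤ.- δ Q P n
  δ-neg Q P n with em {Q ≈ᵖ P}
  ... | yes _ = ≡.refl
  ... | no  _ = ≡.refl

  δ-mono : ∀ Q P {m n} → m ℤ.≤ n → δ Q P m ℤ.≤ δ Q P n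
  δ-mono Q P m≤n with em {Q ≈ᵖ P}
  ... | yes _ = m≤n
  ... | no  _ = ℤ.≤-refl

  δ-0 : ∀ Q P → δ Q P ℤ.0ℤ ≡ ℤ.0ℤ
  δ-0 Q P with em {Q ≈ᵖ P}
  ... | yes _ = ≡.refl
  ... | no  _ = ≡.refl

  δ-cong : ∀ R P Q n → P ≈ᵖ Q → δ R P n ≡ δ R Q n
  δ-cong R P Q n P≈Q with em {R ≈ᵖ P} | em {R ≈ᵖ Q}
  ... | yes _   | yes _   = ≡.refl
  ... | yes R≈P | no  R≉Q = contradiction (λ z → ≡.trans (R≈P z) (P≈Q z)) R≉Q
  ... | no  R≉P | yes R≈Q = contradiction (λ z → ≡.trans (R≈Q z) (≡.sym (P≈Q z))) R≉P
  ... | no  _   | no  _   = ≡.refl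

  coeff-cong : ∀ D P Q → P ≈ᵖ Q → coeff D P ≡ coeff D Q
  coeff-cong []            P Q P≈Q = ≡.refl
  coeff-cong ((n , R) ∷ D) P Q P≈Q = ≡.cong₂ ℤ._+_ (δ-cong R P Q n P≈Q) (coeff-cong D P Q P≈Q)

  ≈ᵖ-refl : ∀ P → P ≈ᵖ P
  ≈ᵖ-refl P z = ≡.refl

  L-isSubspace : ∀ D → IsSubspace (L D)
  L-isSubspace D = record
    { resp     = λ z≈w z∈ P → V.≤v-resp P z≈w (z∈ P)
    ; 0∈       = λ P → V.≤v-zero P refl
    ; +-closed = λ z∈ w∈ P → V.≤v-+ P (z∈ P) (w∈ P)
    ; ι-closed = λ a z∈ P → V.≤v-ι* P a (z∈ P)
    }

  L-mono : ∀ D E → (∀ P → coeff D P ℤ.≤ coeff E P) → L D ⊆ L E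
  L-mono D E D≤E z∈ P = V.≤v-weaken P (ℤ.neg-mono-≤ (D≤E P)) (z∈ P)

  -- Residues lie in `K`, so the class of 1 is a basis of the residue field.
  placeDegree : ∀ P → PlaceDegree P 1
  placeDegree P = (λ _ → 1#) , (λ _ → lift (V.≤v-≡ P ℤ.≤-refl (V.v-1 P))) ,
    (λ { a (lift 1≤) zero → decidable-stable em λ a≉0 →
      1≰0 (≡.subst (_ ≤⁺_) (Place.v-const P (a zero) a≉0) (V.≤v-resp P (single a) 1≤)) }) ,
    λ { z (lift 0≤z) → let a , res = R.residue-exists P 0≤z in
      (λ _ → a) , lift (V.≤v-resp P (+-congˡ (-‿cong (sym (single λ _ → a)))) res) }
    where
    single : ∀ a → comb {1} a (λ _ → 1#) ≈ ι (a zero)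
    single a = trans (+-identityʳ _) (*-identityʳ _)

  module AddPlace (P : Place) (D : Divisor) where

    D+P : Divisor
    D+P = (ℤ.1ℤ , P) ∷ D

    -- An element of L(D + P) attaining the largest pole order allowed at `P`, that is, one lying
    -- outside `L D`.
    Jump : Set ℓ
    Jump = ∃[ w ] w ∈ L D+P × v P w ≡ [ ℤ.- (ℤ.1ℤ ℤ.+ coeff D P) ]

    coeff-D+P : coeff D+P P ≡ ℤ.1ℤ ℤ.+ coeff D P
    coeff-D+P = ≡.cong (ℤ._+ coeff D P) (δ-≈ P P ℤ.1ℤ (≈ᵖ-refl P))

    L-D⊆L-D+P : L D ⊆ L D+P
    L-D⊆L-D+P = L-mono D D+P λ Q → ≡.subst (ℤ._≤ coeff D+P Q) (ℤ.+-identityˡ (coeff D Q))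
      (ℤ.+-monoˡ-≤ (coeff D Q) (≡.subst (ℤ._≤ δ P Q ℤ.1ℤ) (δ-0 P Q) (δ-mono P Q (ℤ.+≤+ ℕ.z≤n))))

    -- The two divisors differ at `P` alone, so only the condition at `P` has to be sharpened.
    lower-pole : ∀ {z} → z ∈ L D+P → [ ℤ.- coeff D P ] ≤⁺ v P z → z ∈ L D
    lower-pole {z} z∈ c≤z Q = split em
      where
      split : Dec (P ≈ᵖ Q) → [ ℤ.- coeff D Q ] ≤⁺ v Q z
      split (yes P≈Q) = ≡.subst₂ (λ c k → [ ℤ.- c ] ≤⁺ k) (coeff-cong D P Q P≈Q) (P≈Q z) c≤z
      split (no  P≉Q) = ≡.subst (λ c → [ ℤ.- c ] ≤⁺ v Q z)
        (≡.trans (≡.cong (ℤ._+ coeff D Q) (δ-≉ P Q ℤ.1ℤ P≉Q)) (ℤ.+-identityˡ _)) (z∈ Q)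

    pole≤ : ∀ {z} → z ∈ L D+P → [ ℤ.- (ℤ.1ℤ ℤ.+ coeff D P) ] ≤⁺ v P z
    pole≤ {z} z∈ = ≡.subst (λ c → [ ℤ.- c ] ≤⁺ v P z) coeff-D+P (z∈ P)

    -- Subtracting from `z` the multiple of `w` with the same leading coefficient at `P` lowers the
    -- pole, so `w` completes a basis of `L D` to one of L(D + P).
    jump : ∀ {n} → Jump → Dim (L D) n → Dim (L D+P) (suc n)
    jump (w , w∈ , vw) dim = dim-extend {L D+P} {L D} (L-isSubspace D) (λ {z} → L-D⊆L-D+P {z}) dim w∈
      (λ w∈D → ℤ.<-irrefl ≡.refl (ℤ.suc[i]≤j⇒i<j
        (≡.subst (ℤ._≤ ℤ.- (ℤ.1ℤ ℤ.+ coeff D P)) (≡.sym (suc-neg (coeff D P))) ([≤]-injective (≡.subst ([ ℤ.- coeff D P ] ≤⁺_) vw (w∈D P))))))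
      λ {z} z∈ → let a , z-aw = R.residue-of-quotient P vw (pole≤ z∈) in
        a , lower-pole
          (+-closed z∈ (resp (trans (*-congʳ (ι-neg a)) (sym (-‿distribˡ-* _ w))) (ι-closed (K.- a) w∈)))
          (≡.subst (λ c → [ c ] ≤⁺ v P (z - ι a * w)) (suc-neg (coeff D P)) z-aw)
      where open IsSubspace (L-isSubspace D+P)

    no-jump : ∀ {n} → ¬ Jump → Dim (L D) n → Dim (L D+P) n
    no-jump ¬jump = dim-resp {L D} {L D+P} (λ {z} → L-D⊆L-D+P {z}) λ {z} z∈ → lower-pole z∈
      (decidable-stable (≤⁺-dec ℤ._≤?_ _ _) λ c≰z → ¬jump (z , z∈ , ≤≱suc⇒≡ (pole≤ z∈)
        λ 1+c≤z → c≰z (≡.subst (λ c → [ c ] ≤⁺ v P z) (suc-neg (coeff D P)) 1+c≤z)))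

  -- Membership of k in the Weierstrass semigroup of `P`.
  NonGap : Place → ℕ → Set ℓ
  NonGap P k = ∃[ f ] v P f ≡ [ ℤ.- + k ] × (∀ Q → ¬ (P ≈ᵖ Q) → [ ℤ.0ℤ ] ≤⁺ v Q f)

  nonGap-0 : ∀ P → NonGap P 0
  nonGap-0 P = 1# , V.v-1 P , λ Q _ → V.≤v-≡ Q ℤ.≤-refl (V.v-1 Q)

  nonGap-+ : ∀ P {a b} → NonGap P a → NonGap P b → NonGap P (a ℕ.+ b)
  nonGap-+ P {a} {b} (f , vf , f≥) (h , vh , h≥) = f * h ,
    ≡.trans (V.v-*-≡ P vf vh) (≡.cong [_] (≡.trans (≡.sym (ℤ.neg-distrib-+ (+ a) (+ b))) (≡.cong ℤ.-_ (≡.sym (ℤ.pos-+ a b))))) ,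
    λ Q P≉Q → V.≤v-* Q (f≥ Q P≉Q) (h≥ Q P≉Q)

  module Gaps (g : ℕ) (isGenus : IsGenus g) (P : Place) where
    open IsGenus isGenus
    open Counting em
    open AddPlace P

    private
      D₀ = proj₁ attained
      d₀ = proj₁ (proj₂ attained)
      n₀ = proj₁ (proj₂ (proj₂ attained))
      degree₀ = proj₁ (proj₂ (proj₂ (proj₂ attained)))
      dim₀ = proj₁ (proj₂ (proj₂ (proj₂ (proj₂ attained))))
      genus₀ = proj₂ (proj₂ (proj₂ (proj₂ (proj₂ attained))))

      -- Without a jump, D₀ + P would have the same dimension as D₀ and a degree larger by one,
      -- exceeding the maximum g.
      jump₀ : Jump D₀
      jump₀ = decidable-stable em λ ¬jump → ℤ.<-irrefl ≡.refl (ℤ.suc[i]≤j⇒i<j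
        (≡.subst₂ ℤ._≤_ (degree-suc d₀ (+ n₀)) (≡.sym genus₀)
          (bound (D+P D₀) _ n₀ (placeDegree P ∷ degree₀) (no-jump D₀ ¬jump dim₀))))

      h = proj₁ jump₀

    -- Otherwise the powers of z, multiplied by h, would make L (D₀ + P) infinite dimensional.
    L-[-P]≈0 : ∀ {z} → z ∈ L ((ℤ.-1ℤ , P) ∷ []) → z ≈ 0#
    L-[-P]≈0 {z} z∈ = decidable-stable em λ z≉0 → absurd z≉0 (dim-dependent {L (D+P D₀)} (jump D₀ jump₀ dim₀) (λ i → h * z ^ toℕ i) (hz^∈ ∘ toℕ))
      where
      0≤z : ∀ Q → [ ℤ.0ℤ ] ≤⁺ v Q z
      0≤z Q = V.≤v-weaken Q (ℤ.neg-mono-≤ (≡.subst₂ ℤ._≤_ (≡.sym (ℤ.+-identityʳ _)) (δ-0 P Q) (δ-mono P Q ℤ.-≤+))) (z∈ Q)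

      1≤z : [ ℤ.1ℤ ] ≤⁺ v P z
      1≤z = ≡.subst (λ c → [ ℤ.- (c ℤ.+ ℤ.0ℤ) ] ≤⁺ v P z) (δ-≈ P P ℤ.-1ℤ (≈ᵖ-refl P)) (z∈ P)

      z^≥0 : ∀ Q m → [ ℤ.0ℤ ] ≤⁺ v Q (z ^ m)
      z^≥0 Q zero    = V.≤v-≡ Q ℤ.≤-refl (V.v-1 Q)
      z^≥0 Q (suc m) = V.≤v-* Q (0≤z Q) (z^≥0 Q m)

      hz^∈ : ∀ m → h * z ^ m ∈ L (D+P D₀)
      hz^∈ m Q = ≡.subst (λ c → [ c ] ≤⁺ v Q (h * z ^ m)) (ℤ.+-identityʳ _)
        (V.≤v-* Q (proj₁ (proj₂ jump₀) Q) (z^≥0 Q m))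

      absurd : z ≉ 0# → ¬ (∃[ a ] (∃[ i ] a i K.≉ K.0#) × comb a (λ i → h * z ^ toℕ i) ≈ 0#)
      absurd z≉0 (a , (i , ai≉0) , eq) = ai≉0 (ι-injective₀ (V.horner-independent P (ι ∘ a) z≉0 1≤z
        (λ j ιa≉0 → Place.v-const P (a j) λ a≈0 → ιa≉0 (trans (ι-cong a≈0) ι-0))
        (*-cancelˡ-≈0 (V.v-≡⇒≉0 P (proj₂ (proj₂ jump₀))) (begin
          h * V.horner P (ι ∘ a) z                  ≈⟨ *-congˡ (V.∑-powers P (ι ∘ a) z) ⟨
          h * ∑ (λ i → ι (a i) * z ^ toℕ i)         ≈⟨ comb-* h a (λ i → z ^ toℕ i) ⟨
          comb a (λ i → h * z ^ toℕ i)              ≈⟨ eq ⟩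
          0#                                        ∎)) i))

    -- ladder k is (k − 1) P, whose Riemann–Roch space is 0 for k = 0.
    ladder : ℕ → Divisor
    ladder zero    = (ℤ.-1ℤ , P) ∷ []
    ladder (suc k) = D+P (ladder k)

    -- Kept in the unevaluated shape that `_HasDegree_` produces; its value is found in `degree≡`.
    degree : ℕ → ℤ
    degree zero    = ℤ.-1ℤ ℤ.* ℤ.1ℤ ℤ.+ ℤ.0ℤ
    degree (suc k) = ℤ.1ℤ ℤ.* ℤ.1ℤ ℤ.+ degree k

    degree-ladder : ∀ k → ladder k HasDegree degree k
    degree-ladder zero    = placeDegree P ∷ []
    degree-ladder (suc k) = placeDegree P ∷ degree-ladder k

    degree≡ : ∀ k → degree k ≡ + k ℤ.- ℤ.1ℤ
    degree≡ zero    = ≡.refl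
    degree≡ (suc k) = ≡.trans (≡.cong (λ d → ℤ.1ℤ ℤ.+ d) (degree≡ k)) (≡.sym (ℤ.+-assoc ℤ.1ℤ (+ k) ℤ.-1ℤ))

    coeff-ladder-P : ∀ k → ℤ.1ℤ ℤ.+ coeff (ladder k) P ≡ + k
    coeff-ladder-P zero    = ≡.cong (λ c → ℤ.1ℤ ℤ.+ (c ℤ.+ ℤ.0ℤ)) (δ-≈ P P ℤ.-1ℤ (≈ᵖ-refl P))
    coeff-ladder-P (suc k) = ≡.cong (λ c → ℤ.1ℤ ℤ.+ c) (≡.trans (coeff-D+P (ladder k)) (coeff-ladder-P k))

    coeff-ladder : ∀ k Q → ¬ (P ≈ᵖ Q) → coeff (ladder k) Q ≡ ℤ.0ℤ
    coeff-ladder zero    Q P≉Q = ≡.cong (ℤ._+ ℤ.0ℤ) (δ-≉ P Q ℤ.-1ℤ P≉Q)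
    coeff-ladder (suc k) Q P≉Q = ≡.cong₂ ℤ._+_ (δ-≉ P Q ℤ.1ℤ P≉Q) (coeff-ladder k Q P≉Q)

    nonGap⇒jump : ∀ {k} → NonGap P k → Jump (ladder k)
    nonGap⇒jump {k} (f , vf , f≥) = f , (λ Q → split Q em) ,
      ≡.trans vf (≡.cong (λ c → [ ℤ.- c ]) (≡.sym (coeff-ladder-P k)))
      where
      split : ∀ Q → Dec (P ≈ᵖ Q) → [ ℤ.- coeff (ladder (suc k)) Q ] ≤⁺ v Q f
      split Q (yes P≈Q) = ≡.subst₂ (λ c m → [ ℤ.- c ] ≤⁺ m)
        (≡.trans (≡.sym (≡.trans (coeff-D+P (ladder k)) (coeff-ladder-P k))) (coeff-cong (ladder (suc k)) P Q P≈Q))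
        (≡.trans (≡.sym vf) (P≈Q f)) (≤∞-reflexive ≡.refl)
      split Q (no P≉Q) = ≡.subst (λ c → [ ℤ.- c ] ≤⁺ v Q f) (≡.sym (coeff-ladder (suc k) Q P≉Q)) (f≥ Q P≉Q)

    jump⇒nonGap : ∀ {k} → Jump (ladder k) → NonGap P k
    jump⇒nonGap {k} (w , w∈ , vw) = w , ≡.trans vw (≡.cong (λ c → [ ℤ.- c ]) (coeff-ladder-P k)) ,
      λ Q P≉Q → ≡.subst (λ c → [ ℤ.- c ] ≤⁺ v Q w) (coeff-ladder (suc k) Q P≉Q) (w∈ Q)

    -- Starting from the zero space, the k-th step adds a dimension exactly when k is a pole order.
    -- The pole orders counted are those below k, matching the divisor (k - 1)P.
    dim-ladder : ∀ k → Dim (L (ladder k)) (count (NonGap P) k)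
    dim-ladder zero    = (λ ()) , (λ ()) , (λ _ _ ()) , λ z z∈ → (λ ()) , trans (x-0≈x z) (L-[-P]≈0 z∈)
    dim-ladder (suc k) with em {NonGap P k}
    ... | yes nonGap = jump (ladder k) (nonGap⇒jump nonGap) (dim-ladder k)
    ... | no  gap    = no-jump (ladder k) (gap ∘ jump⇒nonGap) (dim-ladder k)

    -- The inequality defining the genus, for (k - 1)P: its degree is k - 1 and its dimension is the
    -- number of pole orders below k.
    gaps≤g : ∀ k → k ℕ.≤ g ℕ.+ count (NonGap P) k
    gaps≤g k = ℤ.drop‿+≤+ (≡.subst₂ ℤ._≤_ (deg-dim (+ k) (+ n)) (≡.sym (ℤ.pos-+ g n))
      (ℤ.+-monoˡ-≤ (+ n) (≡.subst (λ d → d ℤ.- + n ℤ.+ ℤ.1ℤ ℤ.≤ + g) (degree≡ k)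
        (bound (ladder k) _ _ (degree-ladder k) (dim-ladder k)))))
      where
      n = count (NonGap P) k

    nonGap-≥2g : ∀ k → 2 ℕ.* g ℕ.≤ k → NonGap P k
    nonGap-≥2g = semigroup-gaps (NonGap P) g (nonGap-+ P) gaps≤g

-- Cardinalities of finite sets.

sum-upTo-suc : ∀ (c : ℕ → ℕ) n → sum (map c (upTo (suc n))) ≡ sum (map c (upTo n)) ℕ.+ c n
sum-upTo-suc c n = ≡.trans (≡.cong (sum ∘ map c) (≡.sym (List.upTo-∷ʳ n)))
  (≡.trans (≡.cong sum (List.map-++ c (upTo n) (n ∷ [])))
    (≡.trans (sum-++ (map c (upTo n)) (c n ∷ [])) (≡.cong (sum (map c (upTo n)) ℕ.+_) (ℕ.+-identityʳ (c n)))))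

sum-const : ∀ c n → sum (map (const c) (upTo n)) ≡ n ℕ.* c
sum-const c zero    = ≡.refl
sum-const c (suc n) = ≡.trans (sum-upTo-suc (const c) n) (≡.trans (≡.cong (ℕ._+ c) (sum-const c n)) (ℕ.+-comm (n ℕ.* c) c))

module _ {a p : Level} {A : Set a} where

  card-≐ : ∀ {q} (S : Pred A p) (T : Pred A q) {n} → S ≐ T → HasCard S n → HasCard T n
  card-≐ S T (S⊆T , T⊆S) (xs , unique , ∈⇔ , len) = xs , unique ,
    (λ x → mk⇔ (Equivalence.to (∈⇔ x) ∘ T⊆S) (S⊆T ∘ Equivalence.from (∈⇔ x))) , len

  card-∪ : (S T : Pred A p) {m n : ℕ} → (∀ {x} → x ∈ S → ¬ x ∈ T) →
    HasCard S m → HasCard T n → HasCard (S ∪ T) (m ℕ.+ n)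
  card-∪ S T disjoint (xs , uxs , xs⇔ , lxs) (ys , uys , ys⇔ , lys) = xs ++ ys ,
    Unique.++⁺ uxs uys (λ { (∈xs , ∈ys) → disjoint (Equivalence.from (xs⇔ _) ∈xs) (Equivalence.from (ys⇔ _) ∈ys) }) ,
    (λ x → mk⇔ Sum.[ ∈-++⁺ˡ ∘ Equivalence.to (xs⇔ x) , ∈-++⁺ʳ xs ∘ Equivalence.to (ys⇔ x) ]
               (Sum.[ inj₁ ∘ Equivalence.from (xs⇔ x) , inj₂ ∘ Equivalence.from (ys⇔ x) ] ∘ ∈-++⁻ xs)) ,
    ≡.trans (List.length-++ xs) (≡.cong₂ ℕ._+_ lxs lys)

  -- Excluded middle decides membership, so an enumeration of the subset is filtered out of any list
  -- containing it.
  card-subset : ExcludedMiddle p → (S : Pred A p) (xs : List A) → Unique xs → (∀ {x} → x ∈ S → x ∈ˡ xs) → ∃[ n ] HasCard S n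
  card-subset em S xs unique S⊆xs = _ , filter S? xs , Unique.filter⁺ S? unique ,
    (λ x → mk⇔ (λ x∈S → ∈-filter⁺ S? (S⊆xs x∈S) x∈S) (proj₂ ∘ ∈-filter⁻ S? {xs = xs})) , ≡.refl
    where
    S? : ∀ x → Dec (x ∈ S)
    S? x = em

  card-⋃ : (S : ℕ → Pred A p) (c : ℕ → ℕ) → (∀ k → HasCard (S k) (c k)) →
    (∀ {j k x} → x ∈ S j → x ∈ S k → j ≡ k) →
    ∀ n → HasCard (λ x → ∃[ k ] k ℕ.< n × x ∈ S k) (sum (map c (upTo n)))
  card-⋃ S c card disjoint zero = [] , [] , (λ x → mk⇔ (λ { (_ , () , _) }) λ ()) , ≡.refl
  card-⋃ S c card disjoint (suc n) = ≡.subst (HasCard _) (≡.sym (sum-upTo-suc c n))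
    (card-≐ (⋃S ∪ S n) (λ x → ∃[ k ] k ℕ.< suc n × x ∈ S k) (join , split) (card-∪ ⋃S (S n) (λ { (k , k<n , x∈Sk) x∈Sn → ℕ.<-irrefl (disjoint x∈Sk x∈Sn) k<n })
      (card-⋃ S c card disjoint n) (card n)))
    where
    ⋃S : Pred A p
    ⋃S x = ∃[ k ] k ℕ.< n × x ∈ S k

    join : ⋃S ∪ S n ⊆ (λ x → ∃[ k ] k ℕ.< suc n × x ∈ S k)
    join (inj₁ (k , k<n , x∈)) = k , ℕ.m<n⇒m<1+n k<n , x∈
    join (inj₂ x∈)             = n , ℕ.n<1+n n , x∈

    split : (λ x → ∃[ k ] k ℕ.< suc n × x ∈ S k) ⊆ ⋃S ∪ S n
    split (k , k<1+n , x∈) with ℕ.m≤n⇒m<n∨m≡n (ℕ.s≤s⁻¹ k<1+n)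
    ... | inj₁ k<n    = inj₁ (k , k<n , x∈)
    ... | inj₂ ≡.refl = inj₂ x∈

card-⊕ : ∀ {p} (S : Pred (ℤ × ℤ) p) {n} w → HasCard S n → HasCard (S ⊕ w) n
card-⊕ S (w₁ , w₂) (xs , unique , ∈⇔ , len) = map shift xs , Unique.map⁺ injective unique ,
  (λ x → mk⇔ to from) , ≡.trans (List.length-map shift xs) len
  where
  shift : ℤ × ℤ → ℤ × ℤ
  shift (s₁ , s₂) = s₁ ℤ.+ w₁ , s₂ ℤ.+ w₂

  injective : ∀ {x y} → shift x ≡ shift y → x ≡ y
  injective eq = ≡.cong₂ _,_ (ℤ-Group.∙-cancelʳ w₁ _ _ (≡.cong proj₁ eq)) (ℤ-Group.∙-cancelʳ w₂ _ _ (≡.cong proj₂ eq))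

  to : ∀ {x} → (S ⊕ (w₁ , w₂)) x → x ∈ˡ map shift xs
  to (s₁ , s₂ , s∈ , ≡.refl) = ∈-map⁺ shift (Equivalence.to (∈⇔ (s₁ , s₂)) s∈)

  from : ∀ {x} → x ∈ˡ map shift xs → (S ⊕ (w₁ , w₂)) x
  from x∈ with ∈-map⁻ shift x∈
  ... | (s₁ , s₂) , s∈ , eq = s₁ , s₂ , Equivalence.from (∈⇔ _) s∈ , eq

-- Ceilings and half-open intervals of length π.

-- `ceiling` unfolds to minus the floor of -n/π, so this is the division inequality for -n, negated.
≤⌈/⌉* : ∀ n π .{{_ : NonZero π}} → n ℤ.≤ ceiling (n / π) ℤ.* + π
≤⌈/⌉* n (suc d) = ≡.subst₂ ℤ._≤_ (ℤ.neg-involutive n) (ℤ.neg-distribˡ-* (ℤ.- n ℤ./ + suc d) (+ suc d))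
  (ℤ.neg-mono-≤ (ℤ.[n/d]*d≤n (ℤ.- n) (+ suc d)))

⌈/⌉-1<⇒≤* : ∀ n π .{{_ : NonZero π}} k → ceiling (n / π) ℤ.- ℤ.1ℤ ℤ.< + k → n ℤ.≤ + (k ℕ.* π)
⌈/⌉-1<⇒≤* n π k c-1<k = ℤ.≤-trans (≤⌈/⌉* n π) (≡.subst (ceiling (n / π) ℤ.* + π ℤ.≤_) (≡.sym (ℤ.pos-* k π))
  (ℤ.*-monoʳ-≤-nonNeg (+ π) (≡.subst (ℤ._≤ + k) (suc-pred (ceiling (n / π))) (ℤ.i<j⇒suc[i]≤j c-1<k))))
  where
  suc-pred : ∀ i → ℤ.suc (i ℤ.- ℤ.1ℤ) ≡ i
  suc-pred i = ≡.trans (≡.cong ℤ.suc (ℤ.+-comm i ℤ.-1ℤ)) (ℤ.suc-pred i)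

-- The intervals are open on the left and closed on the right, so the index of a + 1 is the quotient
-- of its predecessor a.
interval-exists : ∀ π .{{_ : NonZero π}} a → ∃[ i ] + (i ℕ.* π) ℤ.< + suc a × + suc a ℤ.≤ + (suc i ℕ.* π)
interval-exists π a = a ℕ./ π ,
  ℤ.+<+ (ℕ.s≤s (ℕ.m/n*n≤m a π)) ,
  ℤ.+≤+ (≡.subst (ℕ._< π ℕ.+ a ℕ./ π ℕ.* π) (≡.sym (ℕ.m≡m%n+[m/n]*n a π)) (ℕ.+-monoˡ-< (a ℕ./ π ℕ.* π) (ℕ.m%n<n a π)))

interval-unique : ∀ π i j {s} → + (i ℕ.* π) ℤ.< s → s ℤ.≤ + (suc i ℕ.* π) →
  + (j ℕ.* π) ℤ.< s → s ℤ.≤ + (suc j ℕ.* π) → i ≡ j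
interval-unique π i j i<s s≤i j<s s≤j = ℕ.≤-antisym (below i<s s≤j) (below j<s s≤i)
  where
  below : ∀ {i j s} → + (i ℕ.* π) ℤ.< s → s ℤ.≤ + (suc j ℕ.* π) → i ℕ.≤ j
  below {i} {j} i<s s≤j = ℕ.s≤s⁻¹ (ℕ.*-cancelʳ-< π i (suc j) (ℤ.drop‿+<+ (ℤ.<-≤-trans i<s s≤j)))

private module _ where
  open Data.Integer.Solver.+-*-Solver

  -- The zeros are those with which `coeff` ends its sum over a two-term divisor.
  coeff-translate : ∀ x₁ x₂ a b → (x₁ ℤ.+ a) ℤ.+ ((x₂ ℤ.+ b) ℤ.+ ℤ.0ℤ) ≡ (x₁ ℤ.+ (x₂ ℤ.+ ℤ.0ℤ)) ℤ.+ (a ℤ.+ (b ℤ.+ ℤ.0ℤ))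
  coeff-translate = solve 4 (λ x₁ x₂ a b → (x₁ :+ a) :+ ((x₂ :+ b) :+ con ℤ.0ℤ) := (x₁ :+ (x₂ :+ con ℤ.0ℤ)) :+ (a :+ (b :+ con ℤ.0ℤ))) ≡.refl

  neg-translate : ∀ c e → ℤ.- (c ℤ.+ e) ≡ ℤ.- e ℤ.+ ℤ.- c
  neg-translate = solve 2 (λ c e → :- (c :+ e) := :- e :+ :- c) ≡.refl

  neg-translate⁻¹ : ∀ c e → ℤ.- c ≡ e ℤ.+ ℤ.- (c ℤ.+ e)
  neg-translate⁻¹ = solve 2 (λ c e → :- c := e :+ :- (c :+ e)) ≡.refl

  i+j-j≡i : ∀ i j → i ℤ.+ j ℤ.+ ℤ.- j ≡ i
  i+j-j≡i = solve 2 (λ i j → i :+ j :+ :- j := i) ≡.refl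

  i-j+j≡i : ∀ i j → i ℤ.+ ℤ.- j ℤ.+ j ≡ i
  i-j+j≡i = solve 2 (λ i j → i :+ :- j :+ j := i) ≡.refl

  neg-pred : ∀ c → ℤ.- (ℤ.-1ℤ ℤ.+ c) ≡ ℤ.suc (ℤ.- c)
  neg-pred = solve 1 (λ c → :- (con ℤ.-1ℤ :+ c) := con ℤ.1ℤ :+ :- c) ≡.refl

-- Pure gaps: translation, emptiness and the count.

module PureGaps {ℓ} (em : ExcludedMiddle ℓ) (K F : HeytingField ℓ ℓ ℓ)
         (ι : Field.Carrier K → Field.Carrier F) (isHom : IsFieldHom K F ι)
         (closed : IsAlgebraicallyClosed K) (functionField : Polynomial.IsFunctionField K F ι) where
  open FieldExtension em K F ι isHom
  open FunctionField em K F ι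
  open Dimension em K F ι isHom
  open RiemannRochSpaces em K F ι isHom closed functionField
  private
    module V = Valuation em K F ι isHom

  -- If `E` is the divisor of `f`, division by `f` carries `L D` onto L(D + E). Divisors being
  -- lists, D + E is any `D′` with the right coefficients.
  translate-dim : ∀ D D′ E {n} → IsPrincipal E → (∀ Q → coeff D′ Q ≡ coeff D Q ℤ.+ coeff E Q) → RRDim D n → RRDim D′ n
  translate-dim D D′ E (f , f≉0 , vf) D′≡D+E with ≉0⇒invertible f≉0
  ... | h , fh≈1 = dim-scale {L D} {L D′} (trans (*-comm h f) fh≈1) (IsSubspace.resp (L-isSubspace D))
    (λ {z} z∈ Q → ≡.subst (λ c → [ c ] ≤⁺ v Q (h * z))
      (≡.trans (≡.sym (neg-translate (coeff D Q) (coeff E Q))) (≡.cong ℤ.-_ (≡.sym (D′≡D+E Q))))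
      (V.≤v-* Q (V.≤v-≡ Q ℤ.≤-refl (V.v-inverse Q fh≈1 (vf Q))) (z∈ Q)))
    (λ {z} z∈ Q → ≡.subst (λ c → [ c ] ≤⁺ v Q (f * z))
      (≡.trans (≡.cong (λ c → coeff E Q ℤ.+ ℤ.- c) (D′≡D+E Q)) (≡.sym (neg-translate⁻¹ (coeff D Q) (coeff E Q))))
      (V.≤v-* Q (V.≤v-≡ Q ℤ.≤-refl (vf Q)) (z∈ Q)))

  -- Equal dimensions would make `L D` and L(D - P) coincide, but the pole of `f` at `P` is too
  -- large for the latter.
  exact-pole⇒not-pure : ∀ D P f → f ∈ L D → v P f ≡ [ ℤ.- coeff D P ] → ¬ (∃[ n ] RRDim D n × RRDim ((ℤ.-1ℤ , P) ∷ D) n)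
  exact-pole⇒not-pure D P f f∈ vf (n , dim , dim′) =
    f∉ (dim-≡⇒⊆ {L D} {L D′} (L-isSubspace D′) (λ {z} → L-mono D′ D smaller {z}) dim dim′ f∈)
    where
    D′ = (ℤ.-1ℤ , P) ∷ D

    smaller : ∀ Q → coeff D′ Q ℤ.≤ coeff D Q
    smaller Q = ≡.subst (coeff D′ Q ℤ.≤_) (ℤ.+-identityˡ (coeff D Q))
      (ℤ.+-monoˡ-≤ (coeff D Q) (≡.subst (δ P Q ℤ.-1ℤ ℤ.≤_) (δ-0 P Q) (δ-mono P Q ℤ.-≤+)))

    f∉ : ¬ f ∈ L D′
    f∉ f∈ = ℤ.<-irrefl ≡.refl (ℤ.suc[i]≤j⇒i<j (≡.subst (ℤ._≤ ℤ.- coeff D P) (neg-pred (coeff D P)) ([≤]-injective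
      (≡.subst₂ (λ c m → [ ℤ.- (c ℤ.+ coeff D P) ] ≤⁺ m) (δ-≈ P P ℤ.-1ℤ (≈ᵖ-refl P)) vf (f∈ P)))))

  module Pair (P₁ P₂ : Place) (P₁≉P₂ : ¬ (P₁ ≈ᵖ P₂)) where
    open TwoPlaces P₁ P₂

    -- Adding a principal divisor changes none of the four dimensions involved. Nonnegativity of the
    -- coordinates is the one condition not invariant under translation, so it is assumed of the
    -- result.
    G₀-translate : ∀ {s₁ s₂} a b → IsPrincipal (a • b) → ℤ.0ℤ ℤ.≤ s₁ ℤ.+ a → ℤ.0ℤ ℤ.≤ s₂ ℤ.+ b →
      (s₁ , s₂) ∈ G₀ → (s₁ ℤ.+ a , s₂ ℤ.+ b) ∈ G₀
    G₀-translate {s₁} {s₂} a b principal 0≤s₁ 0≤s₂ (_ , _ , (n , dim , dim₁) , (m , dim′ , dim₂)) =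
      0≤s₁ , 0≤s₂ , (n , move dim , move₁ dim₁) , (m , move dim′ , move₂ dim₂)
      where
      coeff-+ : ∀ Q → coeff ((s₁ ℤ.+ a) • (s₂ ℤ.+ b)) Q ≡ coeff (s₁ • s₂) Q ℤ.+ coeff (a • b) Q
      coeff-+ Q = ≡.trans (≡.cong₂ (λ x y → x ℤ.+ (y ℤ.+ ℤ.0ℤ)) (δ-+ P₁ Q s₁ a) (δ-+ P₂ Q s₂ b))
        (coeff-translate (δ P₁ Q s₁) (δ P₂ Q s₂) (δ P₁ Q a) (δ P₂ Q b))

      move : ∀ {n} → RRDim (s₁ • s₂) n → RRDim ((s₁ ℤ.+ a) • (s₂ ℤ.+ b)) n
      move = translate-dim (s₁ • s₂) ((s₁ ℤ.+ a) • (s₂ ℤ.+ b)) (a • b) principal coeff-+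

      move-minus : ∀ P {n} → RRDim ((ℤ.-1ℤ , P) ∷ s₁ • s₂) n → RRDim ((ℤ.-1ℤ , P) ∷ (s₁ ℤ.+ a) • (s₂ ℤ.+ b)) n
      move-minus P = translate-dim ((ℤ.-1ℤ , P) ∷ s₁ • s₂) ((ℤ.-1ℤ , P) ∷ (s₁ ℤ.+ a) • (s₂ ℤ.+ b)) (a • b) principal
        λ Q → ≡.trans (≡.cong (λ c → δ P Q ℤ.-1ℤ ℤ.+ c) (coeff-+ Q)) (≡.sym (ℤ.+-assoc (δ P Q ℤ.-1ℤ) _ _))

      move₁ = move-minus P₁
      move₂ = move-minus P₂

    principal-neg : ∀ a b → IsPrincipal (a • b) → IsPrincipal ((ℤ.- a) • (ℤ.- b))
    principal-neg a b (f , f≉0 , vf) with ≉0⇒invertible f≉0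
    ... | h , fh≈1 = h , inverse-≉0 (trans (*-comm h f) fh≈1) , λ Q → ≡.trans (V.v-inverse Q fh≈1 (vf Q))
      (≡.cong [_] (≡.trans (ℤ.neg-distrib-+ (δ P₁ Q a) _) (≡.cong₂ ℤ._+_ (≡.sym (δ-neg P₁ Q a))
        (≡.trans (ℤ.neg-distrib-+ (δ P₂ Q b) ℤ.0ℤ) (≡.cong (ℤ._+ ℤ.0ℤ) (≡.sym (δ-neg P₂ Q b)))))))

    principal-+ : ∀ a b c d → IsPrincipal (a • b) → IsPrincipal (c • d) → IsPrincipal ((a ℤ.+ c) • (b ℤ.+ d))
    principal-+ a b c d (f , f≉0 , vf) (h , h≉0 , vh) = f * h , *-≉0 f≉0 h≉0 , λ Q → ≡.trans (V.v-*-≡ Q (vf Q) (vh Q))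
      (≡.cong [_] (≡.sym (≡.trans (≡.cong₂ (λ x y → x ℤ.+ (y ℤ.+ ℤ.0ℤ)) (δ-+ P₁ Q a c) (δ-+ P₂ Q b d))
        (coeff-translate (δ P₁ Q a) (δ P₂ Q b) (δ P₁ Q c) (δ P₂ Q d)))))

    principal-multiple : ∀ π j → IsPrincipal ((+ π) • (ℤ.- + π)) → IsPrincipal ((+ (j ℕ.* π)) • (ℤ.- + (j ℕ.* π)))
    principal-multiple π zero    _ = 1# , 1≉0 , λ Q → ≡.trans (V.v-1 Q)
      (≡.cong [_] (≡.sym (≡.cong₂ (λ x y → x ℤ.+ (y ℤ.+ ℤ.0ℤ)) (δ-0 P₁ Q) (δ-0 P₂ Q))))
    principal-multiple π (suc j) principal = ≡.subst₂ (λ a b → IsPrincipal (a • b))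
      (≡.sym (ℤ.pos-+ π (j ℕ.* π)))
      (≡.trans (≡.sym (ℤ.neg-distrib-+ (+ π) (+ (j ℕ.* π)))) (≡.cong ℤ.-_ (≡.sym (ℤ.pos-+ π (j ℕ.* π)))))
      (principal-+ (+ π) (ℤ.- + π) (+ (j ℕ.* π)) (ℤ.- + (j ℕ.* π)) principal (principal-multiple π j principal))

    0≤δ+0 : ∀ P Q {n} → ℤ.0ℤ ℤ.≤ n → ℤ.0ℤ ℤ.≤ δ P Q n ℤ.+ ℤ.0ℤ
    0≤δ+0 P Q 0≤n = ≡.subst₂ ℤ._≤_ (δ-0 P Q) (≡.sym (ℤ.+-identityʳ _)) (δ-mono P Q 0≤n)

    P₂≉P₁ : ¬ (P₂ ≈ᵖ P₁)
    P₂≉P₁ P₂≈P₁ = P₁≉P₂ λ z → ≡.sym (P₂≈P₁ z)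

    -- As s₂ ≥ 0, a function whose only pole is of order k at P₁ lies in L(kP₁ + s₂P₂), and its pole
    -- at P₁ is exactly the one allowed.
    nonGap⇒∉G₀ : ∀ {k s₂} → NonGap P₁ k → ¬ (+ k , s₂) ∈ G₀
    nonGap⇒∉G₀ {k} {s₂} (f , vf , f≥) (_ , 0≤s₂ , pure₁ , _) = exact-pole⇒not-pure ((+ k) • s₂) P₁ f f∈
      (≡.trans vf (≡.cong (λ c → [ ℤ.- c ]) (≡.sym (≡.trans (≡.cong₂ (λ x y → x ℤ.+ (y ℤ.+ ℤ.0ℤ))
        (δ-≈ P₁ P₁ (+ k) (≈ᵖ-refl P₁)) (δ-≉ P₂ P₁ s₂ P₂≉P₁)) (ℤ.+-identityʳ (+ k)))))) pure₁
      where
      f∈ : f ∈ L ((+ k) • s₂)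
      f∈ Q = split em
        where
        split : Dec (P₁ ≈ᵖ Q) → [ ℤ.- coeff ((+ k) • s₂) Q ] ≤⁺ v Q f
        split (yes P₁≈Q) = V.≤v-≡ Q (ℤ.neg-mono-≤ (≡.subst (ℤ._≤ coeff ((+ k) • s₂) Q)
          (≡.trans (ℤ.+-identityʳ _) (δ-≈ P₁ Q (+ k) P₁≈Q))
          (ℤ.+-monoʳ-≤ (δ P₁ Q (+ k)) (0≤δ+0 P₂ Q 0≤s₂)))) (≡.trans (≡.sym (P₁≈Q f)) vf)
        split (no  P₁≉Q) = V.≤v-weaken Q (ℤ.neg-mono-≤ (≡.subst (ℤ.0ℤ ℤ.≤_)
          (≡.sym (≡.trans (≡.cong (ℤ._+ (δ P₂ Q s₂ ℤ.+ ℤ.0ℤ)) (δ-≉ P₁ Q (+ k) P₁≉Q)) (ℤ.+-identityˡ _)))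
          (0≤δ+0 P₂ Q 0≤s₂))) (f≥ Q P₁≉Q)

    s₂≡0⇒∉G₀ : ∀ {s₁} → ¬ (s₁ , ℤ.0ℤ) ∈ G₀
    s₂≡0⇒∉G₀ {s₁} (0≤s₁ , _ , _ , pure₂) = exact-pole⇒not-pure (s₁ • ℤ.0ℤ) P₂ 1#
      (λ Q → V.≤v-≡ Q (ℤ.neg-mono-≤ (≡.subst (ℤ.0ℤ ℤ.≤_) (≡.cong (λ x → δ P₁ Q s₁ ℤ.+ (x ℤ.+ ℤ.0ℤ)) (≡.sym (δ-0 P₂ Q)))
        (0≤δ+0 P₁ Q 0≤s₁))) (V.v-1 Q))
      (≡.trans (V.v-1 P₂) (≡.cong (λ c → [ ℤ.- c ]) (≡.sym (≡.cong₂ (λ x y → x ℤ.+ (y ℤ.+ ℤ.0ℤ))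
        (δ-≉ P₁ P₂ s₁ P₁≉P₂) (δ-0 P₂ P₂))))) pure₂

    -- The boxes begin just above zero, so they cover `G₀` only if no pure gap has a zero
    -- coordinate; the constant 1 rules such pairs out.
    G₀-positive : ∀ {s₁ s₂} → (s₁ , s₂) ∈ G₀ → ∃[ a ] ∃[ b ] s₁ ≡ + suc a × s₂ ≡ + suc b
    G₀-positive {+ zero}  {s₂}        s∈ = contradiction s∈ (nonGap⇒∉G₀ (nonGap-0 P₁))
    G₀-positive {+ suc a} {+ zero}    s∈ = contradiction s∈ s₂≡0⇒∉G₀
    G₀-positive {+ suc a} {+ suc b}   s∈ = a , b , ≡.refl , ≡.refl
    G₀-positive {+ suc a} { -[1+ b ]} (_ , () , _)
    G₀-positive { -[1+ a ]} (() , _)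

    module Period (π : ℕ) .{{_ : NonZero π}} (principal : IsPrincipal ((+ π) • (ℤ.- + π))) where
      open Boxes π

      translate-< : ∀ {a p s} d → p ≡ a ℤ.+ d → a ℤ.< s → p ℤ.< s ℤ.+ d
      translate-< d ≡.refl a<s = ℤ.+-monoˡ-< d a<s

      translate-≤ : ∀ {a p s} d → p ≡ a ℤ.+ d → s ℤ.≤ a → s ℤ.+ d ℤ.≤ p
      translate-≤ d ≡.refl s≤a = ℤ.+-monoˡ-≤ d s≤a

      0≤ : ∀ {n s} → + n ℤ.< s → ℤ.0ℤ ℤ.≤ s
      0≤ n<s = ℤ.<⇒≤ (ℤ.≤-<-trans (ℤ.+≤+ ℕ.z≤n) n<s)

      +-multiple : ∀ i j → + ((i ℕ.+ j) ℕ.* π) ≡ + (i ℕ.* π) ℤ.+ + (j ℕ.* π)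
      +-multiple i j = ≡.trans (≡.cong (λ m → + m) (ℕ.*-distribʳ-+ π i j)) (ℤ.pos-+ (i ℕ.* π) (j ℕ.* π))

      -multiple : ∀ i j → + (i ℕ.* π) ≡ + ((i ℕ.+ j) ℕ.* π) ℤ.+ ℤ.- + (j ℕ.* π)
      -multiple i j = ≡.sym (≡.trans (≡.cong (ℤ._+ ℤ.- + (j ℕ.* π)) (+-multiple i j)) (i+j-j≡i (+ (i ℕ.* π)) (+ (j ℕ.* π))))

      shift-up : ∀ i j {s₁ s₂} → (s₁ , s₂) ∈ G i j → (s₁ ℤ.+ + (j ℕ.* π) , s₂ ℤ.+ ℤ.- + (j ℕ.* π)) ∈ G (i ℕ.+ j) 0
      shift-up i j (s∈ , (l₁ , u₁) , (l₂ , u₂)) =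
        -- Nonnegativity after the shift is read off from the strict lower bounds of the target box.
        G₀-translate J (ℤ.- J) (principal-multiple π j principal) (0≤ l₁′) (0≤ l₂′) s∈ ,
        (l₁′ , translate-≤ J (+-multiple (suc i) j) u₁) ,
        (l₂′ , translate-≤ (ℤ.- J) (-multiple 1 j) u₂)
        where
        J = + (j ℕ.* π)
        l₁′ = translate-< J (+-multiple i j) l₁
        l₂′ = translate-< (ℤ.- J) (-multiple 0 j) l₂

      shift-down : ∀ i j {s₁ s₂} → (s₁ , s₂) ∈ G (i ℕ.+ j) 0 → (s₁ ℤ.+ ℤ.- + (j ℕ.* π) , s₂ ℤ.+ + (j ℕ.* π)) ∈ G i j
      shift-down i j (s∈ , (l₁ , u₁) , (l₂ , u₂)) =
        G₀-translate (ℤ.- J) J (≡.subst (λ b → IsPrincipal ((ℤ.- J) • b)) (ℤ.neg-involutive J)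
          (principal-neg J (ℤ.- J) (principal-multiple π j principal))) (0≤ l₁′) (0≤ l₂′) s∈ ,
        (l₁′ , translate-≤ (ℤ.- J) (-multiple (suc i) j) u₁) ,
        (l₂′ , translate-≤ J (+-multiple 1 j) u₂)
        where
        J = + (j ℕ.* π)
        l₁′ = translate-< (ℤ.- J) (-multiple i j) l₁
        l₂′ = translate-< J (+-multiple 0 j) l₂

      G-translate : ∀ i j → G i j ≐ (G (i ℕ.+ j) 0 ⊕ w j)
      G-translate i j =
        (λ { {s₁ , s₂} s∈ → _ , _ , shift-up i j s∈ , ≡.cong₂ _,_ (≡.sym (i+j-j≡i s₁ (+ (j ℕ.* π)))) (≡.sym (i-j+j≡i s₂ (+ (j ℕ.* π)))) }) ,
        λ { (s₁ , s₂ , s∈ , ≡.refl) → shift-down i j s∈ }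

      G-card : ∀ k → ∃[ n ] HasCard (G k 0) n
      G-card k = card-subset em (G k 0) box (Unique.cartesianProduct⁺ (side-unique (suc k ℕ.* π)) (side-unique (1 ℕ.* π)))
        λ { (_ , (l₁ , u₁) , (l₂ , u₂)) → ∈-cartesianProduct⁺ (∈-side (0≤ l₁) u₁) (∈-side (0≤ l₂) u₂) }
        where
        side : ℕ → List ℤ
        side n = map +_ (upTo (suc n))
        box = cartesianProduct (side (suc k ℕ.* π)) (side (1 ℕ.* π))

        side-unique : ∀ n → Unique (side n)
        side-unique n = Unique.map⁺ ℤ.+-injective (Unique.upTo⁺ (suc n))

        ∈-side : ∀ {n s} → ℤ.0ℤ ℤ.≤ s → s ℤ.≤ + n → s ∈ˡ side n
        ∈-side (ℤ.+≤+ _) (ℤ.+≤+ s≤n) = ∈-map⁺ +_ (∈-upTo⁺ (ℕ.s≤s s≤n))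

      G₀-box : ∀ {s} → s ∈ G₀ → ∃[ i ] ∃[ j ] s ∈ G i j
      G₀-box s∈ with G₀-positive s∈
      ... | a , b , ≡.refl , ≡.refl =
        let i , i<a , a≤i = interval-exists π a
            j , j<b , b≤j = interval-exists π b
        in i , j , s∈ , (i<a , a≤i) , (j<b , b≤j)

      G-disjoint : ∀ {i j i′ j′ s} → s ∈ G i j → s ∈ G i′ j′ → i ≡ i′ × j ≡ j′
      G-disjoint {i} {j} {i′} {j′} (_ , (l₁ , u₁) , (l₂ , u₂)) (_ , (l₁′ , u₁′) , (l₂′ , u₂′)) =
        interval-unique π i i′ l₁ u₁ l₁′ u₁′ , interval-unique π j j′ l₂ u₂ l₂′ u₂′

      -- The boxes are grouped by k = i + j. Each diagonal consists of k + 1 disjoint translates of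
      -- `G k 0`, one for each j from 0 to k.
      G₀-card : ∀ (c : ℕ → ℕ) → (∀ k → HasCard (G k 0) (c k)) → ∀ n → (∀ k {s} → s ∈ G k 0 → k ℕ.< n) →
        HasCard G₀ (sum (map (λ k → suc k ℕ.* c k) (upTo n)))
      G₀-card c card n bound = card-≐ (λ s → ∃[ k ] k ℕ.< n × s ∈ diagonal k) G₀ (diagonals⊆G₀ , G₀⊆diagonals)
        (card-⋃ diagonal (λ k → suc k ℕ.* c k) diagonal-card
          (λ {k} {k′} {s} → diagonal-disjoint {k} {k′} {s}) n)
        where
        diagonal : ℕ → Pred (ℤ × ℤ) ℓ
        diagonal k s = ∃[ j ] j ℕ.< suc k × s ∈ (G k 0 ⊕ w j)

        ⊕⇒G : ∀ k {j s} → j ℕ.< suc k → s ∈ (G k 0 ⊕ w j) → s ∈ G (k ℕ.∸ j) j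
        ⊕⇒G k {j} {s} j<1+k s∈ = proj₂ (G-translate (k ℕ.∸ j) j)
          {s} (≡.subst (λ k → s ∈ (G k 0 ⊕ w j)) (≡.sym (ℕ.m∸n+n≡m (ℕ.s≤s⁻¹ j<1+k))) s∈)

        -- The second coordinate alone determines j, which makes the translates within a diagonal
        -- disjoint.
        row : ∀ {k j s} → s ∈ (G k 0 ⊕ w j) → + (j ℕ.* π) ℤ.< proj₂ s × proj₂ s ℤ.≤ + (suc j ℕ.* π)
        row {j = j} (s₁ , s₂ , (_ , _ , (l₂ , u₂)) , ≡.refl) =
          translate-< (+ (j ℕ.* π)) (+-multiple 0 j) l₂ , translate-≤ (+ (j ℕ.* π)) (+-multiple 1 j) u₂

        diagonal-card : ∀ k → HasCard (diagonal k) (suc k ℕ.* c k)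
        diagonal-card k = ≡.subst (HasCard (diagonal k)) (sum-const (c k) (suc k))
          (card-⋃ (λ j → G k 0 ⊕ w j) (λ _ → c k) (λ j → card-⊕ (G k 0) (w j) (card k))
            (λ {i} {j} {s} s∈ s∈′ → let l , u = row {k} {i} {s} s∈ ; l′ , u′ = row {k} {j} {s} s∈′ in interval-unique π i j l u l′ u′)
            (suc k))

        diagonal-disjoint : ∀ {k k′ s} → s ∈ diagonal k → s ∈ diagonal k′ → k ≡ k′
        diagonal-disjoint {k} {k′} {s} (j , j≤k , s∈) (j′ , j′≤k′ , s∈′)
            with G-disjoint {k ℕ.∸ j} {j} {k′ ℕ.∸ j′} {j′} {s} (⊕⇒G k {j} {s} j≤k s∈) (⊕⇒G k′ {j′} {s} j′≤k′ s∈′)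
        ... | eq , ≡.refl = ≡.trans (≡.sym (ℕ.m∸n+n≡m (ℕ.s≤s⁻¹ j≤k)))
          (≡.trans (≡.cong (ℕ._+ j) eq) (ℕ.m∸n+n≡m (ℕ.s≤s⁻¹ j′≤k′)))

        diagonals⊆G₀ : (λ s → ∃[ k ] k ℕ.< n × s ∈ diagonal k) ⊆ G₀
        diagonals⊆G₀ {s} (k , _ , j , j≤k , s∈) = proj₁ (⊕⇒G k {j} {s} j≤k s∈)

        G₀⊆diagonals : G₀ ⊆ (λ s → ∃[ k ] k ℕ.< n × s ∈ diagonal k)
        G₀⊆diagonals {s} s∈ with G₀-box {s} s∈
        ... | i , j , s∈G = i ℕ.+ j , bound (i ℕ.+ j) (shift-up i j s∈G) ,
          j , ℕ.s≤s (ℕ.m≤n+m j i) , proj₁ (G-translate i j) {s} s∈G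

      G-empty : ∀ g → IsGenus g → ∀ k → + 2 ℤ.* + g ℤ.- + 1 ℤ.≤ + (k ℕ.* π) → ∀ {s} → ¬ s ∈ G k 0
      G-empty g isGenus k 2g-1≤kπ {s₁ , s₂} (s∈ , (l₁ , _) , _) with G₀-positive s∈
      ... | a , _ , ≡.refl , _ = nonGap⇒∉G₀ (Gaps.nonGap-≥2g g isGenus P₁ (suc a) (ℤ.drop‿+≤+
        (≡.subst₂ ℤ._≤_ (≡.sym (ℤ.pos-* 2 g)) ≡.refl
          (≡.subst (ℤ._≤ + suc a) (suc-pred (+ 2 ℤ.* + g)) (ℤ.i<j⇒suc[i]≤j (ℤ.≤-<-trans 2g-1≤kπ l₁)))))) s∈
        where
        suc-pred : ∀ i → ℤ.suc (i ℤ.- ℤ.1ℤ) ≡ i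
        suc-pred i = ≡.trans (≡.cong ℤ.suc (ℤ.+-comm i ℤ.-1ℤ)) (ℤ.suc-pred i)

      G₀-card-∑₀ : ∀ g → IsGenus g → ∀ (c : ℕ → ℕ) → (∀ k → HasCard (G k 0) (c k)) →
        HasCard G₀ (∑₀ (ceiling ((+ 2 ℤ.* + g ℤ.- + 1) / π) ℤ.- + 1) (λ k → suc k ℕ.* c k))
      G₀-card-∑₀ g isGenus c card = split _ (λ k <k {s} → G-empty g isGenus k (⌈/⌉-1<⇒≤* (+ 2 ℤ.* + g ℤ.- + 1) π k <k) {s})
        where
        split : ∀ m → (∀ k → m ℤ.< + k → ∀ {s} → ¬ s ∈ G k 0) → HasCard G₀ (∑₀ m (λ k → suc k ℕ.* c k))
        split (+ n)    empty = G₀-card c card (suc n) λ k {s} s∈ → ℕ.≰⇒> λ n<k → empty k (ℤ.+<+ n<k) {s} s∈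
        -- The limit is negative only for genus 0; then even `G 0 0` is empty, in agreement with the
        -- empty sum.
        split -[1+ n ] empty = G₀-card c card 0 λ k {s} s∈ → contradiction s∈ (empty k ℤ.-<+ {s})

proposition3p4 : ∀ {ℓ} (em : ExcludedMiddle ℓ)
    (𝔽 K F : HeytingField ℓ ℓ ℓ) (q : ℕ)
    (σ : Field.Carrier 𝔽 → Field.Carrier K)
    (ι : Field.Carrier K → Field.Carrier F) →
    HasOrder 𝔽 q →
    IsAlgebraicClosure 𝔽 K σ →
    IsFieldHom K F ι →
    Polynomial.IsFunctionField K F ι →
    let open FunctionField em K F ι in
    ∀ (g : ℕ) → IsGenus g →
    ∀ (P₁ P₂ : Place) → ¬ (P₁ ≈ᵖ P₂) →
    let open TwoPlaces P₁ P₂ in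
    ∀ (π : ℕ) .{{_ : NonZero π}} → IsPeriod π →
    let open Boxes π in
    (∀ i j → G i j ≐ (G (i ℕ.+ j) 0 ⊕ w j))
    × (Σ (ℕ → ℕ) λ c → (∀ k → HasCard (G k 0) (c k))
    × HasCard G₀ (∑₀ (ceiling ((+ 2 ℤ.* + g ℤ.- + 1) / π) ℤ.- + 1) (λ k → suc k ℕ.* c k)))
proposition3p4 em 𝔽 K F q σ ι _ closure isHom functionField g isGenus P₁ P₂ P₁≉P₂ π isPeriod =
  G-translate , (λ k → proj₁ (G-card k)) , (λ k → proj₂ (G-card k)) ,
  G₀-card-∑₀ g isGenus (λ k → proj₁ (G-card k)) (λ k → proj₂ (G-card k))
  where
  open PureGaps em K F ι isHom (IsAlgebraicClosure.isAlgebraicallyClosed closure) functionField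
  open Pair P₁ P₂ P₁≉P₂
  open Period π (FunctionField.TwoPlaces.IsPeriod.principal isPeriod)
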